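{- For each $w\in W/W_P$, the irreducible component $Z_{P,w}$ of $Z_P$ is contained in the closed subspace of $Z_P$ where $\mathrm{Ad}(g_1^{ -1})\nu\in\mathfrak{n}_Q$ if and only if $ww_0\cdot\lambda$ is a dominant weight for $\mathfrak{m}_Q$.
   Context: $L$ is a finite extension of $\mathbb{Q}_p$, $\Sigma_p$ a finite index set (the set of embeddings into $L$ of the $p$-adic completions of a totally real field), $G=\prod_{\tau\in\Sigma_p}\mathrm{GL}_{n/L}$, $T\subset B$ the diagonal torus and the upper-triangular Borel subgroup, $W=\prod_{\tau\in\Sigma_p}\mathcal{S}_n$ the Weyl group, $w_0$ its longest element. $\lambda=(\lambda_{\tau,i})\in\prod_{\tau\in\Sigma_p}\mathbb{Z}^n$ is a weight with $\lambda_{\tau,i}-\lambda_{\tau,i+1}\ge-1$ for all $\tau$ and $1\le i\le n-1$. $w\cdot\mu=w(\mu+\rho_0)-\rho_0$ is the dot action, $\rho_0$ the half sum of the positive roots with respect to $B$. $P\supset B$ is the standard parabolic subgroup such that the Weyl group $W_P$ of its standard Levi subgroup is the stabilizer of $w_0\cdot\lambda$ under the dot action; thus $ww_0\cdot\lambda$ depends only on $w\in W/W_P$. $Q\supset B$ is any standard parabolic subgroup, with Lie algebra $\mathfrak{q}=\mathfrak{m}_Q+\mathfrak{n}_Q$, $\mathfrak{m}_Q$ the block-diagonal Levi subalgebra and $\mathfrak{n}_Q$ the nilpotent radical. A weight $\mu$ is dominant for $\mathfrak{m}_Q$ if $\langle\alpha^\vee,\mu\rangle\ge0$ for every simple root $\alpha$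 of $\mathfrak m_Q$ (positive with respect to $B$). $\mathfrak{g},\mathfrak{p}$ are the Lie algebras of $G,P$ and $\mathfrak{u}$ the nilpotent radical of the Lie algebra of $B$. The generalized Steinberg variety is $$Z_P=\{(\nu,g_1B,g_2P)\in\mathfrak g\times G/B\times G/P\mid\mathrm{Ad}(g_1^{ -1})\nu\in\mathfrak u,\ \mathrm{Ad}(g_2^{ -1})\nu\in\mathfrak p\},$$ and for $w\in W/W_P$, $Z_{P,w}$ is the Zariski closure (with reduced structure) of $\{(\nu,g_1B,g_2P)\in Z_P\mid g_1^{ -1}g_2\in BwP\}$; these are the irreducible components of $Z_P$. -}

module Defs where

open import Level using (Level; _⊔_) renaming (suc to lsuc)
open import Algebra.Apartness.Bundles using (HeytingField)
open import Algebra.Bundles using (CommutativeRing)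
open import Algebra.Morphism.Structures using (module RingMorphisms)
import Algebra.Properties.CommutativeSemiring.Exp as Exp
import Algebra.Properties.Monoid.Sum as Sum
import Algebra.Properties.Ring as RingProperties
import Algebra.Solver.Ring.NaturalCoefficients.Default as NaturalSolver
open import Data.Bool.Base using (if_then_else_)
open import Data.Fin.Base using (Fin; toℕ)
import Data.Fin.Base as Fin
import Data.Fin.Properties as Fin
open import Data.Fin.Permutation
  using (Permutation′; _⟨$⟩ʳ_; _⟨$⟩ˡ_; _∘ₚ_; reverse)
open import Data.Integer.Base as ℤ using (ℤ; +_)
open import Data.Integer.Divisibility.Signed
  using (_∣_; divides; ∣m∣n⇒∣m+n; ∣m⇒∣-m; ∣n⇒∣m*n; ∣m⇒∣m*n)
import Data.Integer.Properties as ℤ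
open import Data.Integer.Tactic.RingSolver as ℤSolver using ()
open import Data.List.Base using (_∷_; [])
open import Data.Nat.Base as ℕ using (ℕ; suc; _^_)
open import Data.Product.Base using (∃; ∃₂; _×_; _,_; proj₁; proj₂)
open import Data.Rational.Base as ℚ using (ℚ; 0ℚ; 1ℚ; ½)
import Data.Rational.Properties as ℚ
open import Function.Bundles using (_⇔_)
open import Relation.Binary.PropositionalEquality as ≡ using (_≡_)
import Relation.Binary.Reasoning.Setoid as SetoidReasoning
open import Relation.Nullary.Decidable using (does)
open import Relation.Unary using (Pred)

private
  variable
    c ℓ ℓ₁ ℓ₂ : Level

-- An element of lim ℤ/pⁿ is given by compatible integer representatives
-- of its residues modulo pⁿ.
record PadicInteger (p : ℕ) : Set where
  field
    residue  : ℕ → ℤ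
    coherent : ∀ k → + (p ^ k) ∣ residue (suc k) ℤ.- residue k

open PadicInteger

module _ (p : ℕ) where

  private
    infix 4 _≈_
    _≈_ : PadicInteger p → PadicInteger p → Set
    x ≈ y = ∀ k → + (p ^ k) ∣ residue x k ℤ.- residue y k

    by : ∀ {d a b} → a ≡ b → d ∣ a → d ∣ b
    by ≡.refl h = h

    equal : ∀ x y → (∀ k → residue x k ≡ residue y k) → x ≈ y
    equal x y e k = by (≡.sym (ℤ.i≡j⇒i-j≡0 (e k))) (divides (+ 0) ≡.refl)

    const : ℤ → PadicInteger p
    const a = record
      { residue  = λ _ → a
      ; coherent = λ _ → by (≡.sym (ℤ.i≡j⇒i-j≡0 {a} ≡.refl)) (divides (+ 0) ≡.refl)
      }

    sum-identity : ∀ a b u v → (a ℤ.- b) ℤ.+ (u ℤ.- v) ≡ (a ℤ.+ u) ℤ.- (b ℤ.+ v)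
    sum-identity = ℤSolver.solve-∀

    product-identity : ∀ a b u v →
      a ℤ.* (u ℤ.- v) ℤ.+ (a ℤ.- b) ℤ.* v ≡ a ℤ.* u ℤ.- b ℤ.* v
    product-identity = ℤSolver.solve-∀

    neg-identity : ∀ a b → ℤ.- (a ℤ.- b) ≡ (ℤ.- a) ℤ.- (ℤ.- b)
    neg-identity = ℤSolver.solve-∀

    swap-identity : ∀ a b → ℤ.- (a ℤ.- b) ≡ b ℤ.- a
    swap-identity = ℤSolver.solve-∀

    trans-identity : ∀ a b d → (a ℤ.- b) ℤ.+ (b ℤ.- d) ≡ a ℤ.- d
    trans-identity = ℤSolver.solve-∀

    sum-∣ : ∀ {d} a b u v → d ∣ a ℤ.- b → d ∣ u ℤ.- v → d ∣ (a ℤ.+ u) ℤ.- (b ℤ.+ v)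
    sum-∣ a b u v h h′ = by (sum-identity a b u v) (∣m∣n⇒∣m+n h h′)

    product-∣ : ∀ {d} a b u v → d ∣ a ℤ.- b → d ∣ u ℤ.- v → d ∣ a ℤ.* u ℤ.- b ℤ.* v
    product-∣ a b u v h h′ = by (product-identity a b u v)
      (∣m∣n⇒∣m+n (∣n⇒∣m*n a h′) (∣m⇒∣m*n v h))

    neg-∣ : ∀ {d} a b → d ∣ a ℤ.- b → d ∣ (ℤ.- a) ℤ.- (ℤ.- b)
    neg-∣ a b h = by (neg-identity a b) (∣m⇒∣-m h)

    plus times : PadicInteger p → PadicInteger p → PadicInteger p
    plus x y = record
      { residue  = λ k → residue x k ℤ.+ residue y k
      ; coherent = λ k → sum-∣ (residue x (suc k)) (residue x k)
                           (residue y (suc k)) (residue y k)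
                           (coherent x k) (coherent y k)
      }
    times x y = record
      { residue  = λ k → residue x k ℤ.* residue y k
      ; coherent = λ k → product-∣ (residue x (suc k)) (residue x k)
                           (residue y (suc k)) (residue y k)
                           (coherent x k) (coherent y k)
      }

    negate : PadicInteger p → PadicInteger p
    negate x = record
      { residue  = λ k → ℤ.- residue x k
      ; coherent = λ k → neg-∣ (residue x (suc k)) (residue x k) (coherent x k)
      }

  ℤₚ : CommutativeRing _ _
  ℤₚ = record
    { Carrier = PadicInteger p
    ; _≈_ = _≈_
    ; _+_ = plus
    ; _*_ = times
    ; -_  = negate
    ; 0#  = const (+ 0)
    ; 1#  = const (+ 1)
    ; isCommutativeRing = record
      { isRing = record
        { +-isAbelianGroup = record
          { isGroup = record
            { isMonoid = record
              { isSemigroup = record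
                { isMagma = record
                  { isEquivalence = record
                    { refl  = λ {x} → equal x x (λ _ → ≡.refl)
                    ; sym   = λ {x} {y} h k →
                        by (swap-identity (residue x k) (residue y k)) (∣m⇒∣-m (h k))
                    ; trans = λ {x} {y} {z} h h′ k →
                        by (trans-identity (residue x k) (residue y k) (residue z k))
                           (∣m∣n⇒∣m+n (h k) (h′ k))
                    }
                  ; ∙-cong = λ {x} {y} {u} {v} h h′ k →
                      sum-∣ (residue x k) (residue y k) (residue u k) (residue v k)
                        (h k) (h′ k)
                  }
                ; assoc = λ x y z → equal (plus (plus x y) z) (plus x (plus y z))
                    (λ k → ℤ.+-assoc (residue x k) (residue y k) (residue z k))
                }
              ; identity = (λ x → equal (plus (const (+ 0)) x) x
                              (λ k → ℤ.+-identityˡ (residue x k)))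
                         , (λ x → equal (plus x (const (+ 0))) x
                              (λ k → ℤ.+-identityʳ (residue x k)))
              }
            ; inverse = (λ x → equal (plus (negate x) x) (const (+ 0))
                           (λ k → ℤ.+-inverseˡ (residue x k)))
                      , (λ x → equal (plus x (negate x)) (const (+ 0))
                           (λ k → ℤ.+-inverseʳ (residue x k)))
            ; ⁻¹-cong = λ {x} {y} h k → neg-∣ (residue x k) (residue y k) (h k)
            }
          ; comm = λ x y → equal (plus x y) (plus y x)
              (λ k → ℤ.+-comm (residue x k) (residue y k))
          }
        ; *-cong = λ {x} {y} {u} {v} h h′ k →
            product-∣ (residue x k) (residue y k) (residue u k) (residue v k)
              (h k) (h′ k)
        ; *-assoc = λ x y z → equal (times (times x y) z) (times x (times y z))
            (λ k → ℤ.*-assoc (residue x k) (residue y k) (residue z k))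
        ; *-identity = (λ x → equal (times (const (+ 1)) x) x
                          (λ k → ℤ.*-identityˡ (residue x k)))
                     , (λ x → equal (times x (const (+ 1))) x
                          (λ k → ℤ.*-identityʳ (residue x k)))
        ; distrib = (λ x y z → equal (times x (plus y z)) (plus (times x y) (times x z))
                       (λ k → ℤ.*-distribˡ-+ (residue x k) (residue y k) (residue z k)))
                  , (λ x y z → equal (times (plus y z) x) (plus (times y x) (times z x))
                       (λ k → ℤ.*-distribʳ-+ (residue x k) (residue y k) (residue z k)))
        }
      ; *-comm = λ x y → equal (times x y) (times y x)
          (λ k → ℤ.*-comm (residue x k) (residue y k))
      }
    }

  pₚ : PadicInteger p
  pₚ = const (+ p)

-- The localisation R[1/s]; the pair (a , k) stands for a / sᵏ.
module _ (R : CommutativeRing c ℓ) (s : CommutativeRing.Carrier R) where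

  private
    module R = CommutativeRing R
    open R using (Carrier; _≈_; _+_; _*_; -_; 0#; 1#)
    open Exp R.commutativeSemiring using (^-homo-*) renaming (_^_ to _^ᴿ_)
    open RingProperties R.ring using (-‿distribʳ-*; -‿distribˡ-*)
    open SetoidReasoning R.setoid
    open NaturalSolver R.commutativeSemiring using (solve; _:=_; _:+_; _:*_; con)

    Frac : Set c
    Frac = Carrier × ℕ

    infix 4 _≃_
    record _≃_ (x y : Frac) : Set ℓ where
      constructor _,_
      field
        exponent : ℕ
        equality : s ^ᴿ exponent * (s ^ᴿ proj₂ y * proj₁ x)
                 ≈ s ^ᴿ exponent * (s ^ᴿ proj₂ x * proj₁ y)

    plus times : Frac → Frac → Frac
    plus  (a , k) (b , l) = s ^ᴿ l * a + s ^ᴿ k * b , k ℕ.+ l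
    times (a , k) (b , l) = a * b , k ℕ.+ l

    negate : Frac → Frac
    negate (a , k) = - a , k

    hom : ∀ k l → s ^ᴿ (k ℕ.+ l) ≈ s ^ᴿ k * s ^ᴿ l
    hom = ^-homo-* s

    hom₃ : ∀ k l m → s ^ᴿ (k ℕ.+ l ℕ.+ m) ≈ s ^ᴿ k * s ^ᴿ l * s ^ᴿ m
    hom₃ k l m = R.trans (hom (k ℕ.+ l) m) (R.*-congʳ (hom k l))

    hom₃′ : ∀ k l m → s ^ᴿ (k ℕ.+ (l ℕ.+ m)) ≈ s ^ᴿ k * (s ^ᴿ l * s ^ᴿ m)
    hom₃′ k l m = R.trans (hom k (l ℕ.+ m)) (R.*-congˡ (hom l m))

    direct : ∀ {a k b l} → s ^ᴿ l * a ≈ s ^ᴿ k * b → (a , k) ≃ (b , l)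
    direct h = 0 , R.*-congˡ h

    ≃-sym : ∀ {x y} → x ≃ y → y ≃ x
    ≃-sym (m , h) = m , R.sym h

    ≃-trans : ∀ {x y z} → x ≃ y → y ≃ z → x ≃ z
    ≃-trans {a , k} {b , l} {d , j} (m , h) (m′ , h′) = m ℕ.+ m′ ℕ.+ l , (begin
      s ^ᴿ (m ℕ.+ m′ ℕ.+ l) * (J * a)  ≈⟨ R.*-congʳ (hom₃ m m′ l) ⟩
      M * M′ * Lₛ * (J * a)            ≈⟨ solve 5 (λ m m′ l j a →
                                           m :* m′ :* l :* (j :* a) :=
                                           m′ :* j :* (m :* (l :* a)))
                                           R.refl M M′ Lₛ J a ⟩
      M′ * J * (M * (Lₛ * a))          ≈⟨ R.*-congˡ h ⟩
      M′ * J * (M * (K * b))           ≈⟨ solve 5 (λ m m′ k j b →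
                                           m′ :* j :* (m :* (k :* b)) :=
                                           m :* k :* (m′ :* (j :* b)))
                                           R.refl M M′ K J b ⟩
      M * K * (M′ * (J * b))           ≈⟨ R.*-congˡ h′ ⟩
      M * K * (M′ * (Lₛ * d))          ≈⟨ solve 5 (λ m m′ k l d →
                                           m :* k :* (m′ :* (l :* d)) :=
                                           m :* m′ :* l :* (k :* d))
                                           R.refl M M′ K Lₛ d ⟩
      M * M′ * Lₛ * (K * d)            ≈⟨ R.*-congʳ (hom₃ m m′ l) ⟨
      s ^ᴿ (m ℕ.+ m′ ℕ.+ l) * (K * d)  ∎)
      where
      M = s ^ᴿ m
      M′ = s ^ᴿ m′
      K = s ^ᴿ k
      Lₛ = s ^ᴿ l
      J = s ^ᴿ j

    plus-cong : ∀ {x y u v} → x ≃ y → u ≃ v → plus x u ≃ plus y v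
    plus-cong {a , k} {b , l} {a′ , k′} {b′ , l′} (m , h) (m′ , h′) =
      m ℕ.+ m′ , (begin
      s ^ᴿ (m ℕ.+ m′) * (s ^ᴿ (l ℕ.+ l′) * (K′ * a + K * a′))
        ≈⟨ R.*-cong (hom m m′) (R.*-congʳ (hom l l′)) ⟩
      M * M′ * (Lₛ * L′ * (K′ * a + K * a′))
        ≈⟨ solve 8 (λ m m′ k k′ l l′ a a′ →
             m :* m′ :* (l :* l′ :* (k′ :* a :+ k :* a′)) :=
             m′ :* l′ :* k′ :* (m :* (l :* a)) :+ m :* l :* k :* (m′ :* (l′ :* a′)))
             R.refl M M′ K K′ Lₛ L′ a a′ ⟩
      M′ * L′ * K′ * (M * (Lₛ * a)) + M * Lₛ * K * (M′ * (L′ * a′))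
        ≈⟨ R.+-cong (R.*-congˡ h) (R.*-congˡ h′) ⟩
      M′ * L′ * K′ * (M * (K * b)) + M * Lₛ * K * (M′ * (K′ * b′))
        ≈⟨ solve 8 (λ m m′ k k′ l l′ b b′ →
             m′ :* l′ :* k′ :* (m :* (k :* b)) :+ m :* l :* k :* (m′ :* (k′ :* b′)) :=
             m :* m′ :* (k :* k′ :* (l′ :* b :+ l :* b′)))
             R.refl M M′ K K′ Lₛ L′ b b′ ⟩
      M * M′ * (K * K′ * (L′ * b + Lₛ * b′))
        ≈⟨ R.*-cong (hom m m′) (R.*-congʳ (hom k k′)) ⟨
      s ^ᴿ (m ℕ.+ m′) * (s ^ᴿ (k ℕ.+ k′) * (L′ * b + Lₛ * b′)) ∎)
      where
      M = s ^ᴿ m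
      M′ = s ^ᴿ m′
      K = s ^ᴿ k
      K′ = s ^ᴿ k′
      Lₛ = s ^ᴿ l
      L′ = s ^ᴿ l′

    times-cong : ∀ {x y u v} → x ≃ y → u ≃ v → times x u ≃ times y v
    times-cong {a , k} {b , l} {a′ , k′} {b′ , l′} (m , h) (m′ , h′) =
      m ℕ.+ m′ , (begin
      s ^ᴿ (m ℕ.+ m′) * (s ^ᴿ (l ℕ.+ l′) * (a * a′))
        ≈⟨ R.*-cong (hom m m′) (R.*-congʳ (hom l l′)) ⟩
      M * M′ * (Lₛ * L′ * (a * a′))
        ≈⟨ solve 6 (λ m m′ l l′ a a′ →
             m :* m′ :* (l :* l′ :* (a :* a′)) :=
             m :* (l :* a) :* (m′ :* (l′ :* a′)))
             R.refl M M′ Lₛ L′ a a′ ⟩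
      M * (Lₛ * a) * (M′ * (L′ * a′))
        ≈⟨ R.*-cong h h′ ⟩
      M * (K * b) * (M′ * (K′ * b′))
        ≈⟨ solve 6 (λ m m′ k k′ b b′ →
             m :* (k :* b) :* (m′ :* (k′ :* b′)) :=
             m :* m′ :* (k :* k′ :* (b :* b′)))
             R.refl M M′ K K′ b b′ ⟩
      M * M′ * (K * K′ * (b * b′))
        ≈⟨ R.*-cong (hom m m′) (R.*-congʳ (hom k k′)) ⟨
      s ^ᴿ (m ℕ.+ m′) * (s ^ᴿ (k ℕ.+ k′) * (b * b′)) ∎)
      where
      M = s ^ᴿ m
      M′ = s ^ᴿ m′
      K = s ^ᴿ k
      K′ = s ^ᴿ k′
      Lₛ = s ^ᴿ l
      L′ = s ^ᴿ l′

    negate-cong : ∀ {x y} → x ≃ y → negate x ≃ negate y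
    negate-cong {a , k} {b , l} (m , h) = m , (begin
      s ^ᴿ m * (s ^ᴿ l * - a)    ≈⟨ R.*-congˡ (-‿distribʳ-* _ _) ⟨
      s ^ᴿ m * (- (s ^ᴿ l * a))  ≈⟨ -‿distribʳ-* _ _ ⟨
      - (s ^ᴿ m * (s ^ᴿ l * a))  ≈⟨ R.-‿cong h ⟩
      - (s ^ᴿ m * (s ^ᴿ k * b))  ≈⟨ -‿distribʳ-* _ _ ⟩
      s ^ᴿ m * (- (s ^ᴿ k * b))  ≈⟨ R.*-congˡ (-‿distribʳ-* _ _) ⟩
      s ^ᴿ m * (s ^ᴿ k * - b)    ∎)

    plus-comm : ∀ x y → plus x y ≃ plus y x
    plus-comm (a , k) (b , l) = direct
      (R.*-cong (R.trans (hom l k) (R.trans (R.*-comm _ _) (R.sym (hom k l))))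
        (R.+-comm _ _))

    times-comm : ∀ x y → times x y ≃ times y x
    times-comm (a , k) (b , l) = direct
      (R.*-cong (R.trans (hom l k) (R.trans (R.*-comm _ _) (R.sym (hom k l))))
        (R.*-comm _ _))

    plus-assoc : ∀ x y z → plus (plus x y) z ≃ plus x (plus y z)
    plus-assoc (a , k) (b , l) (d , m) = direct (begin
      s ^ᴿ (k ℕ.+ (l ℕ.+ m)) * (M * (Lₛ * a + K * b) + s ^ᴿ (k ℕ.+ l) * d)
        ≈⟨ R.*-cong (hom₃′ k l m) (R.+-congˡ (R.*-congʳ (hom k l))) ⟩
      K * (Lₛ * M) * (M * (Lₛ * a + K * b) + K * Lₛ * d)
        ≈⟨ solve 6 (λ k l m a b d →
             k :* (l :* m) :* (m :* (l :* a :+ k :* b) :+ k :* l :* d) :=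
             k :* l :* m :* (l :* m :* a :+ k :* (m :* b :+ l :* d)))
             R.refl K Lₛ M a b d ⟩
      K * Lₛ * M * (Lₛ * M * a + K * (M * b + Lₛ * d))
        ≈⟨ R.*-cong (hom₃ k l m) (R.+-congʳ (R.*-congʳ (hom l m))) ⟨
      s ^ᴿ (k ℕ.+ l ℕ.+ m) * (s ^ᴿ (l ℕ.+ m) * a + K * (M * b + Lₛ * d)) ∎)
      where
      K = s ^ᴿ k
      Lₛ = s ^ᴿ l
      M = s ^ᴿ m

    times-assoc : ∀ x y z → times (times x y) z ≃ times x (times y z)
    times-assoc (a , k) (b , l) (d , m) = direct
      (R.*-cong (R.trans (hom₃′ k l m) (R.trans (R.sym (R.*-assoc _ _ _))
        (R.sym (hom₃ k l m)))) (R.*-assoc a b d))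

    plus-identityˡ : ∀ x → plus (0# , 0) x ≃ x
    plus-identityˡ (a , k) = direct (R.*-congˡ
      (R.trans (R.+-cong (R.zeroʳ _) (R.*-identityˡ a)) (R.+-identityˡ a)))

    times-identityˡ : ∀ x → times (1# , 0) x ≃ x
    times-identityˡ (a , k) = direct (R.*-congˡ (R.*-identityˡ a))

    plus-inverseˡ : ∀ x → plus (negate x) x ≃ (0# , 0)
    plus-inverseˡ (a , k) = direct (begin
      1# * (s ^ᴿ k * - a + s ^ᴿ k * a)  ≈⟨ R.*-identityˡ _ ⟩
      s ^ᴿ k * - a + s ^ᴿ k * a         ≈⟨ R.distribˡ _ _ _ ⟨
      s ^ᴿ k * (- a + a)                ≈⟨ R.*-congˡ (R.-‿inverseˡ a) ⟩
      s ^ᴿ k * 0#                       ≈⟨ R.zeroʳ _ ⟩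
      0#                                ≈⟨ R.zeroʳ _ ⟨
      s ^ᴿ (k ℕ.+ k) * 0#               ∎)

    distribˡ : ∀ x y z → times x (plus y z) ≃ plus (times x y) (times x z)
    distribˡ (a , k) (b , l) (d , m) = direct (begin
      s ^ᴿ (k ℕ.+ l ℕ.+ (k ℕ.+ m)) * (a * (M * b + Lₛ * d))
        ≈⟨ R.*-congʳ (R.trans (hom (k ℕ.+ l) (k ℕ.+ m)) (R.*-cong (hom k l) (hom k m))) ⟩
      K * Lₛ * (K * M) * (a * (M * b + Lₛ * d))
        ≈⟨ solve 6 (λ k l m a b d →
             k :* l :* (k :* m) :* (a :* (m :* b :+ l :* d)) :=
             k :* (l :* m) :* (k :* m :* (a :* b) :+ k :* l :* (a :* d)))
             R.refl K Lₛ M a b d ⟩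
      K * (Lₛ * M) * (K * M * (a * b) + K * Lₛ * (a * d))
        ≈⟨ R.*-cong (hom₃′ k l m)
             (R.+-cong (R.*-congʳ (hom k m)) (R.*-congʳ (hom k l))) ⟨
      s ^ᴿ (k ℕ.+ (l ℕ.+ m)) *
        (s ^ᴿ (k ℕ.+ m) * (a * b) + s ^ᴿ (k ℕ.+ l) * (a * d)) ∎)
      where
      K = s ^ᴿ k
      Lₛ = s ^ᴿ l
      M = s ^ᴿ m

  localisation : CommutativeRing c ℓ
  localisation = record
    { Carrier = Frac
    ; _≈_ = _≃_
    ; _+_ = plus
    ; _*_ = times
    ; -_  = negate
    ; 0#  = 0# , 0
    ; 1#  = 1# , 0
    ; isCommutativeRing = record
      { isRing = record
        { +-isAbelianGroup = record
          { isGroup = record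
            { isMonoid = record
              { isSemigroup = record
                { isMagma = record
                  { isEquivalence = record
                    { refl  = direct R.refl
                    ; sym   = ≃-sym
                    ; trans = ≃-trans
                    }
                  ; ∙-cong = plus-cong
                  }
                ; assoc = plus-assoc
                }
              ; identity = plus-identityˡ
                         , (λ x → ≃-trans (plus-comm x (0# , 0)) (plus-identityˡ x))
              }
            ; inverse = plus-inverseˡ
                      , (λ x → ≃-trans (plus-comm x (negate x)) (plus-inverseˡ x))
            ; ⁻¹-cong = negate-cong
            }
          ; comm = plus-comm
          }
        ; *-cong = times-cong
        ; *-assoc = times-assoc
        ; *-identity = times-identityˡ
                     , (λ x → ≃-trans (times-comm x (1# , 0)) (times-identityˡ x))
        ; distrib = distribˡ
                  , (λ x y z → ≃-trans (times-comm (plus y z) x)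
                       (≃-trans (distribˡ x y z)
                         (plus-cong (times-comm x y) (times-comm x z))))
        }
      ; *-comm = times-comm
      }
    }

ℚₚ : ℕ → CommutativeRing _ _
ℚₚ p = localisation (ℤₚ p) (pₚ p)

-- Classically a Heyting field is a field, with _#_ the relation _≉_.
fieldRing : HeytingField c ℓ₁ ℓ₂ → CommutativeRing c ℓ₁
fieldRing K = record { isCommutativeRing = HeytingField.isCommutativeRing K }

module _ {c′ ℓ′} (R : CommutativeRing c′ ℓ′) (L : HeytingField c ℓ₁ ℓ₂) where

  private
    module R = CommutativeRing R
    module L = HeytingField L
    open RingMorphisms R.rawRing (CommutativeRing.rawRing (fieldRing L))
      using (IsRingHomomorphism)
    open Sum (CommutativeRing.+-monoid (fieldRing L)) using (sum)

  record IsFiniteExtension : Set (c ⊔ ℓ₁ ⊔ c′ ⊔ ℓ′) where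
    field
      embed              : R.Carrier → L.Carrier
      isRingHomomorphism : IsRingHomomorphism embed
      degree             : ℕ
      basis              : Fin degree → L.Carrier
      spanning           : ∀ x → ∃ λ (a : Fin degree → R.Carrier) →
                             sum (λ i → embed (a i) L.* basis i) L.≈ x
      independent        : ∀ (a : Fin degree → R.Carrier) →
                             sum (λ i → embed (a i) L.* basis i) L.≈ L.0# →
                             ∀ i → a i R.≈ R.0#

record FieldExtension (L : HeytingField c ℓ₁ ℓ₂) : Set (lsuc (c ⊔ ℓ₁ ⊔ ℓ₂)) where
  field
    top : HeytingField c ℓ₁ ℓ₂

  open HeytingField top public using (Carrier; _≈_; _+_; _*_; -_; 0#; 1#)

  ring : CommutativeRing c ℓ₁
  ring = fieldRing top

  open RingMorphisms (CommutativeRing.rawRing (fieldRing L))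
                     (CommutativeRing.rawRing ring) using (IsRingHomomorphism)

  field
    embed              : HeytingField.Carrier L → Carrier
    isRingHomomorphism : IsRingHomomorphism embed

-- A standard parabolic of GLₙ is an ordered partition of the indices into
-- consecutive blocks; `block` labels them increasingly.  Only the order
-- pattern of the labels is used.
record StandardParabolic (n : ℕ) : Set where
  field
    block    : Fin n → ℕ
    monotone : ∀ {i j} → i Fin.≤ j → block i ℕ.≤ block j

open StandardParabolic public

Borel : ∀ {n} → StandardParabolic n
Borel = record { block = toℕ ; monotone = λ i≤j → i≤j }

-- For ∏_τ GLₙ, with τ ranging over Fin r.
module RootDatum (r n : ℕ) where

  Parabolic : Set
  Parabolic = Fin r → StandardParabolic n

  W : Set
  W = Fin r → Permutation′ n

  -- _∘ₚ_ composes diagrammatically.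
  infixl 7 _∙_
  _∙_ : W → W → W
  (w ∙ w′) τ = w′ τ ∘ₚ w τ

  w₀ : W
  w₀ _ = reverse

  -- ρ₀ has half-integral coordinates, so weights are taken in X*(T) ⊗ ℚ.
  Weight : Set
  Weight = Fin r → Fin n → ℚ

  infix 4 _≐_
  _≐_ : Weight → Weight → Set
  μ ≐ μ′ = ∀ τ i → μ τ i ≡ μ′ τ i

  fromIntegral : (Fin r → Fin n → ℤ) → Weight
  fromIntegral μ τ i = μ τ i ℚ./ 1

  ε : Fin n → Fin n → ℚ
  ε i k = if does (i Fin.≟ k) then 1ℚ else 0ℚ

  root : Fin n → Fin n → Fin n → ℚ
  root i j k = ε i k ℚ.- ε j k

  open Sum ℚ.+-0-monoid using (sum)

  ρ₀ : Weight
  ρ₀ _ k = ½ ℚ.* sum (λ i → sum (λ j → if does (i Fin.<? j) then root i j k else 0ℚ))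

  -- (wμ)_{w(i)} = μ_i
  act : W → Weight → Weight
  act w μ τ i = μ τ (w τ ⟨$⟩ˡ i)

  infixr 8 _·_
  _·_ : W → Weight → Weight
  (w · μ) τ i = act w (λ τ i → μ τ i ℚ.+ ρ₀ τ i) τ i ℚ.- ρ₀ τ i

  Adjacent : Fin n → Fin n → Set
  Adjacent i j = toℕ j ≡ suc (toℕ i)

  -- The pairing of the coroot (ε_i − ε_j)^∨ at τ with μ.
  ⟨coroot_,_,_∣_⟩ : Fin r → Fin n → Fin n → Weight → ℚ
  ⟨coroot τ , i , j ∣ μ ⟩ = μ τ i ℚ.- μ τ j

  DominantForLevi : Parabolic → Weight → Set
  DominantForLevi Q μ = ∀ τ i j → Adjacent i j → block (Q τ) i ≡ block (Q τ) j →
    0ℚ ℚ.≤ ⟨coroot τ , i , j ∣ μ ⟩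

  InLeviWeylGroup : Parabolic → W → Set
  InLeviWeylGroup P w = ∀ τ i → block (P τ) (w τ ⟨$⟩ʳ i) ≡ block (P τ) i

  LeviWeylGroupIsStabiliser : Parabolic → Weight → Set
  LeviWeylGroupIsStabiliser P μ = ∀ w → InLeviWeylGroup P w ⇔ w · μ ≐ μ

module Matrices (K : CommutativeRing c ℓ) (n : ℕ) where

  open CommutativeRing K
  open Sum +-monoid using (sum)

  Matrix : Set c
  Matrix = Fin n → Fin n → Carrier

  infix 4 _≋_
  _≋_ : Matrix → Matrix → Set ℓ
  A ≋ B = ∀ i j → A i j ≈ B i j

  infixl 7 _⊡_
  _⊡_ : Matrix → Matrix → Matrix
  (A ⊡ B) i j = sum (λ k → A i k * B k j)

  -- e_i ↦ e_{σ(i)}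
  permutationMatrix : Permutation′ n → Matrix
  permutationMatrix σ i j = if does (i Fin.≟ (σ ⟨$⟩ʳ j)) then 1# else 0#

  identityMatrix : Matrix
  identityMatrix i j = if does (i Fin.≟ j) then 1# else 0#

  record GL : Set (c ⊔ ℓ) where
    field
      matrix   : Matrix
      inverse  : Matrix
      inverseˡ : inverse ⊡ matrix ≋ identityMatrix
      inverseʳ : matrix ⊡ inverse ≋ identityMatrix

  open GL public

  LieParabolic : StandardParabolic n → Matrix → Set ℓ
  LieParabolic P A = ∀ i j → block P j ℕ.< block P i → A i j ≈ 0#

  LieNilradical : StandardParabolic n → Matrix → Set ℓ
  LieNilradical P A = ∀ i j → block P j ℕ.≤ block P i → A i j ≈ 0#

  -- Over a field the second condition follows from the first.
  InParabolic : StandardParabolic n → GL → Set ℓ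
  InParabolic P g = LieParabolic P (matrix g) × LieParabolic P (inverse g)

-- Reduced L-schemes of finite type and their closed subsets are encoded by
-- their K-valued points for all field extensions K of L.  A K-point of
-- 𝔤 × G/B × G/P is represented by a K-point of 𝔤 × G × G; this loses
-- nothing, as G(K) → (G/B)(K) and G(K) → (G/P)(K) are surjective for fields K.
module Steinberg (L : HeytingField c ℓ₁ ℓ₂) (r n : ℕ) where

  open RootDatum r n using (Parabolic; W)

  module _ (K : FieldExtension L) where
    private module M = Matrices (FieldExtension.ring K) n

    record Point : Set (c ⊔ ℓ₁) where
      field
        ν     : Fin r → M.Matrix
        g₁ g₂ : Fin r → M.GL

  Subset : Set (lsuc (c ⊔ ℓ₁ ⊔ ℓ₂))
  Subset = (K : FieldExtension L) → Pred (Point K) (c ⊔ ℓ₁)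

  infix 4 _⊆_
  _⊆_ : Subset → Subset → Set (lsuc (c ⊔ ℓ₁ ⊔ ℓ₂))
  S ⊆ S′ = ∀ K x → S K x → S′ K x

  -- Polynomials in the entries of ν, g₁, g₁⁻¹, g₂, g₂⁻¹: these represent all
  -- regular functions on 𝔤 × G × G.
  data Coordinate : Set where
    νᶜ g₁ᶜ g₁⁻¹ᶜ g₂ᶜ g₂⁻¹ᶜ : Fin r → Fin n → Fin n → Coordinate

  data Polynomial : Set c where
    con     : HeytingField.Carrier L → Polynomial
    var     : Coordinate → Polynomial
    _:+_    : Polynomial → Polynomial → Polynomial
    _:*_    : Polynomial → Polynomial → Polynomial

  module _ {K : FieldExtension L} where
    open FieldExtension K
    open Matrices ring n
    open Point

    coordinate : Point K → Coordinate → Carrier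
    coordinate x (νᶜ τ i j)     = ν x τ i j
    coordinate x (g₁ᶜ τ i j)    = matrix (g₁ x τ) i j
    coordinate x (g₁⁻¹ᶜ τ i j)  = inverse (g₁ x τ) i j
    coordinate x (g₂ᶜ τ i j)    = matrix (g₂ x τ) i j
    coordinate x (g₂⁻¹ᶜ τ i j)  = inverse (g₂ x τ) i j

    evaluate : Point K → Polynomial → Carrier
    evaluate x (con a)  = embed a
    evaluate x (var v)  = coordinate x v
    evaluate x (f :+ g) = evaluate x f + evaluate x g
    evaluate x (f :* g) = evaluate x f * evaluate x g

    Ad⁻¹ : (Fin r → GL) → (Fin r → Matrix) → Fin r → Matrix
    Ad⁻¹ g N τ = inverse (g τ) ⊡ N τ ⊡ matrix (g τ)

    -- Equality of the images in (𝔤 × G/B × G/P)(K).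
    SameImage : Parabolic → Point K → Point K → Set (c ⊔ ℓ₁)
    SameImage P x y =
      (∀ τ → ν x τ ≋ ν y τ) ×
      (∃ λ (b : Fin r → GL) → ∀ τ →
         InParabolic Borel (b τ) × matrix (g₁ y τ) ≋ matrix (g₁ x τ) ⊡ matrix (b τ)) ×
      (∃ λ (q : Fin r → GL) → ∀ τ →
         InParabolic (P τ) (q τ) × matrix (g₂ y τ) ≋ matrix (g₂ x τ) ⊡ matrix (q τ))

    -- g₁⁻¹g₂ ∈ BwP
    RelativePosition : Parabolic → W → Point K → Set (c ⊔ ℓ₁)
    RelativePosition P w x = ∃₂ λ (b q : Fin r → GL) → ∀ τ →
      InParabolic Borel (b τ) × InParabolic (P τ) (q τ) ×
      inverse (g₁ x τ) ⊡ matrix (g₂ x τ)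
        ≋ matrix (b τ) ⊡ permutationMatrix (w τ) ⊡ matrix (q τ)

    InZ : Parabolic → Point K → Set ℓ₁
    InZ P x = (∀ τ → LieNilradical Borel (Ad⁻¹ (g₁ x) (ν x) τ)) ×
              (∀ τ → LieParabolic (P τ) (Ad⁻¹ (g₂ x) (ν x) τ))

    InNilradical : Parabolic → Point K → Set ℓ₁
    InNilradical Q x = ∀ τ → LieNilradical (Q τ) (Ad⁻¹ (g₁ x) (ν x) τ)

    Vanishes : Pred Polynomial c → Point K → Set (c ⊔ ℓ₁)
    Vanishes I x = ∀ f → I f → evaluate x f ≈ 0#

  zeroLocus : Pred Polynomial c → Subset
  zeroLocus I _ x = Vanishes I x

  -- 𝔤 × G × G → 𝔤 × G/B × G/P is open and surjective, so the closed subsets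
  -- of the target are the images of the saturated closed subsets of the source.
  Saturated : Parabolic → Subset → Set (lsuc (c ⊔ ℓ₁ ⊔ ℓ₂))
  Saturated P S = ∀ K x y → SameImage {K} P x y → S K x → S K y

  InClosure : Parabolic → Subset → (K : FieldExtension L) →
    Point K → Set (lsuc (c ⊔ ℓ₁ ⊔ ℓ₂))
  InClosure P S K x = ∀ (I : Pred Polynomial c) → Saturated P (zeroLocus I) →
    S ⊆ zeroLocus I → zeroLocus I K x

  Cell : Parabolic → W → Subset
  Cell P w _ x = InZ P x × RelativePosition P w x

  -- Membership in Z_{P,w}, the closure of the cell inside Z_P.
  InComponent : Parabolic → W → (K : FieldExtension L) →
    Point K → Set (lsuc (c ⊔ ℓ₁ ⊔ ℓ₂))
  InComponent P w K x = InZ P x × InClosure P (Cell P w) K x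

  -- Z_{P,w} is contained in the locus of Z_P where Ad(g₁⁻¹)ν ∈ 𝔫_Q.  As Z_{P,w}
  -- is reduced, this can be tested on field-valued points.
  ComponentContained : Parabolic → W → Parabolic → Set (lsuc (c ⊔ ℓ₁ ⊔ ℓ₂))
  ComponentContained P w Q = ∀ K x → InComponent P w K x → InZ P x × InNilradical Q x

-- Put η = w₀(λ + ρ₀).  By the hypothesis on λ it is weakly increasing on each
-- factor, and as W_P is its stabiliser, its level sets are the blocks of P.
-- The pairing of ww₀·λ with the coroot of (i, i+1) is
-- η(w⁻¹(i)) − η(w⁻¹(i+1)) − 1, so ww₀·λ is dominant for 𝔪_Q iff i ↦ w⁻¹(i)
-- strictly decreases the blocks of P within each block of Q.
-- On the other hand, translating by B, the cell of w is governed by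
-- 𝔲 ∩ Ad(w)𝔭, which is spanned by the E_ij with i < j and w⁻¹(i) in a block of
-- P not after that of w⁻¹(j).  It lies in the B-stable space 𝔫_Q iff none of
-- these E_ij has i and j in the same block of Q: the same condition.
module Submission where

open import Defs
open import Algebra.Apartness.Bundles using (HeytingField)
open import Algebra.Bundles using (CommutativeRing; Monoid)
import Algebra.Morphism.Construct.Identity as Identity
open import Algebra.Morphism.Structures using (module RingMorphisms)
import Algebra.Properties.CommutativeMonoid.Sum as CommutativeMonoidSum
import Algebra.Properties.Monoid as MonoidProperties
import Algebra.Properties.Monoid.Sum as MonoidSum
import Algebra.Properties.Semiring.Sum as SemiringSum
open import Data.Bool.Base using (if_then_else_; true; false)
open import Data.Fin.Base using (Fin; zero; suc; toℕ; opposite)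
import Data.Fin.Base as Fin
open import Data.Fin.Permutation as Perm
  using (Permutation′; _⟨$⟩ʳ_; _⟨$⟩ˡ_; flip)
import Data.Fin.Permutation.Components as PC
open import Data.Fin.Properties
  using (_≟_; _<?_; opposite-prop; suc-injective; toℕ-injective)
open import Data.Integer.Base using (ℤ; _-_; _≤_; -1ℤ)
open import Data.Integer.Base as ℤ using (+_; 0ℤ)
import Data.Integer.Properties as ℤ
open import Data.Integer.Tactic.RingSolver as ℤSolver using ()
open import Data.Nat.Base using (ℕ)
open import Data.Nat.Base as ℕ using (s<s; s<s⁻¹)
open import Data.Nat.Primality using (Prime)
import Data.Nat.Properties as ℕ
open import Data.Product.Base using (_×_; _,_; proj₁; proj₂; swap)
open import Data.Rational.Base as ℚ using (ℚ; 0ℚ; 1ℚ; ½)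
import Data.Rational.Properties as ℚ
open import Data.Rational.Solver using (module +-*-Solver)
open import Data.Rational.Unnormalised.Base as ℚᵘ using (mkℚᵘ; *≡*; *≤*)
import Data.Rational.Unnormalised.Properties as ℚᵘ
open import Data.Sum.Base as Sum using (_⊎_; inj₁; inj₂; [_,_]′)
open import Function.Base using (_∘_; id)
open import Function.Bundles using (_⇔_; mk⇔; module Equivalence)
open import Relation.Binary.PropositionalEquality as ≡ using (_≡_; _≢_)
import Relation.Binary.Reasoning.Setoid as SetoidReasoning
open import Relation.Nullary.Decidable
  using (Dec; does; yes; no; dec-true; dec-false; _×-dec_)
open import Relation.Nullary.Negation using (¬_; contradiction)
open import Relation.Unary using (Pred)

-- Conditionals and finite sums.

if-true : ∀ {a p} {A : Set a} {P : Set p} {x y : A} (P? : Dec P) → P →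
  (if does P? then x else y) ≡ x
if-true {x = x} {y} P? h = ≡.cong (if_then x else y) (dec-true P? h)

if-false : ∀ {a p} {A : Set a} {P : Set p} {x y : A} (P? : Dec P) → ¬ P →
  (if does P? then x else y) ≡ y
if-false {x = x} {y} P? h = ≡.cong (if_then x else y) (dec-false P? h)

module _ {c ℓ} (M : Monoid c ℓ) where
  open Monoid M
  open MonoidSum M

  sum-zero : ∀ {m} (f : Fin m → Carrier) → (∀ k → f k ≈ ε) → sum f ≈ ε
  sum-zero {m} f h = trans (sum-cong-≋ h) (sum-replicate-zero m)

  sum-single : ∀ {m} (f : Fin m → Carrier) i → (∀ k → k ≢ i → f k ≈ ε) → sum f ≈ f i
  sum-single f zero h =
    trans (∙-congˡ (sum-zero (f ∘ suc) λ k → h (suc k) λ ())) (identityʳ (f zero))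
  sum-single f (suc i) h =
    trans (∙-cong (h zero λ ()) (sum-single (f ∘ suc) i λ k k≢i → h (suc k) (k≢i ∘ suc-injective)))
      (identityˡ (f (suc i)))

-- Matrices, conjugation and standard parabolics over a commutative ring.

module MatrixProperties {c ℓ} (K : CommutativeRing c ℓ) (n : ℕ) where
  open CommutativeRing K
  open Matrices K n
  open SemiringSum semiring using (sum; sum-cong-≋; *-distribˡ-sum; *-distribʳ-sum)
  open CommutativeMonoidSum +-commutativeMonoid using (∑-comm)

  sum-*-unitˡ : ∀ (u f : Fin n → Carrier) i → u i ≈ 1# → (∀ k → k ≢ i → u k ≈ 0#) →
    sum (λ k → u k * f k) ≈ f i
  sum-*-unitˡ u f i one zero′ = trans
    (sum-single +-monoid _ i λ k k≢i → trans (*-congʳ (zero′ k k≢i)) (zeroˡ (f k)))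
    (trans (*-congʳ one) (*-identityˡ (f i)))

  sum-*-unitʳ : ∀ (f u : Fin n → Carrier) i → u i ≈ 1# → (∀ k → k ≢ i → u k ≈ 0#) →
    sum (λ k → f k * u k) ≈ f i
  sum-*-unitʳ f u i one zero′ =
    trans (sum-cong-≋ λ k → *-comm (f k) (u k)) (sum-*-unitˡ u f i one zero′)

  permutationMatrix-⊡ : ∀ σ A i j → (permutationMatrix σ ⊡ A) i j ≈ A (σ ⟨$⟩ˡ i) j
  permutationMatrix-⊡ σ A i j = sum-*-unitˡ _ (λ k → A k j) (σ ⟨$⟩ˡ i)
    (reflexive (if-true (i ≟ _) (≡.sym (Perm.inverseʳ σ))))
    λ k k≢ → reflexive (if-false (i ≟ _) λ i≡σk →
      k≢ (≡.sym (≡.trans (≡.cong (σ ⟨$⟩ˡ_) i≡σk) (Perm.inverseˡ σ))))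

  ⊡-permutationMatrix : ∀ A σ i j → (A ⊡ permutationMatrix σ) i j ≈ A i (σ ⟨$⟩ʳ j)
  ⊡-permutationMatrix A σ i j = sum-*-unitʳ (A i) _ (σ ⟨$⟩ʳ j)
    (reflexive (if-true ((σ ⟨$⟩ʳ j) ≟ (σ ⟨$⟩ʳ j)) ≡.refl))
    λ k k≢ → reflexive (if-false (k ≟ _) k≢)

  matrixMonoid : Monoid c ℓ
  matrixMonoid = record
    { Carrier = Matrix
    ; _≈_ = _≋_
    ; _∙_ = _⊡_
    ; ε = identityMatrix
    ; isMonoid = record
      { isSemigroup = record
        { isMagma = record
          { isEquivalence = record
            { refl  = λ i j → refl
            ; sym   = λ h i j → sym (h i j)
            ; trans = λ h h′ i j → trans (h i j) (h′ i j)
            }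
          ; ∙-cong = λ h h′ i j → sum-cong-≋ λ k → *-cong (h i k) (h′ k j)
          }
        ; assoc = ⊡-assoc
        }
      ; identity =
          (λ A i j → sum-*-unitˡ _ (λ k → A k j) i (reflexive (if-true (i ≟ i) ≡.refl))
            λ k k≢i → reflexive (if-false (i ≟ k) (k≢i ∘ ≡.sym)))
        , (λ A i j → sum-*-unitʳ (A i) _ j (reflexive (if-true (j ≟ j) ≡.refl))
            λ k k≢j → reflexive (if-false (k ≟ j) k≢j))
      }
    }
    where
    ⊡-assoc : ∀ A B C → (A ⊡ B) ⊡ C ≋ A ⊡ (B ⊡ C)
    ⊡-assoc A B C i j = begin
      sum (λ l → sum (λ k → A i k * B k l) * C l j)
        ≈⟨ sum-cong-≋ (λ l → *-distribʳ-sum (C l j) (λ k → A i k * B k l)) ⟩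
      sum (λ l → sum (λ k → A i k * B k l * C l j))
        ≈⟨ ∑-comm (λ l k → A i k * B k l * C l j) ⟩
      sum (λ k → sum (λ l → A i k * B k l * C l j))
        ≈⟨ sum-cong-≋ (λ k → sum-cong-≋ λ l → *-assoc (A i k) (B k l) (C l j)) ⟩
      sum (λ k → sum (λ l → A i k * (B k l * C l j)))
        ≈⟨ sum-cong-≋ (λ k → *-distribˡ-sum (A i k) (λ l → B k l * C l j)) ⟨
      sum (λ k → A i k * sum (λ l → B k l * C l j)) ∎
      where open SetoidReasoning setoid

  open Monoid matrixMonoid public
    using () renaming
      (∙-cong to ⊡-cong; ∙-congˡ to ⊡-congˡ; ∙-congʳ to ⊡-congʳ; assoc to ⊡-assoc;
      refl to ≋-refl; sym to ≋-sym; trans to ≋-trans; setoid to ≋-setoid;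
      identityˡ to ⊡-identityˡ; identityʳ to ⊡-identityʳ)
  open MonoidProperties matrixMonoid public using (cancelˡ; cancelʳ; cancelᶜ)

  infixl 7 _⊙_
  _⊙_ : GL → GL → GL
  g ⊙ h = record
    { matrix   = matrix g ⊡ matrix h
    ; inverse  = inverse h ⊡ inverse g
    ; inverseˡ = ≋-trans (cancelᶜ (inverseˡ g) (inverse h) (matrix h)) (inverseˡ h)
    ; inverseʳ = ≋-trans (cancelᶜ (inverseʳ h) (matrix g) (inverse g)) (inverseʳ g)
    }

  _⁻¹ : GL → GL
  g ⁻¹ = record
    { matrix = inverse g ; inverse = matrix g ; inverseˡ = inverseʳ g ; inverseʳ = inverseˡ g }

  𝟏 : GL
  𝟏 = record
    { matrix   = identityMatrix
    ; inverse  = identityMatrix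
    ; inverseˡ = ⊡-identityˡ identityMatrix
    ; inverseʳ = ⊡-identityˡ identityMatrix
    }

  permutationGL : Permutation′ n → GL
  permutationGL σ = record
    { matrix   = permutationMatrix σ
    ; inverse  = permutationMatrix (flip σ)
    ; inverseˡ = flip-inverseˡ σ
    ; inverseʳ = flip-inverseˡ (flip σ)
    }
    where
    entry : ∀ σ i j → permutationMatrix σ (σ ⟨$⟩ʳ i) j ≡ identityMatrix i j
    entry σ i j with i ≟ j
    ... | yes ≡.refl = if-true ((σ ⟨$⟩ʳ i) ≟ (σ ⟨$⟩ʳ i)) ≡.refl
    ... | no i≢j = if-false ((σ ⟨$⟩ʳ i) ≟ (σ ⟨$⟩ʳ j)) λ e →
      i≢j (≡.trans (≡.sym (Perm.inverseˡ σ)) (≡.trans (≡.cong (σ ⟨$⟩ˡ_) e) (Perm.inverseˡ σ)))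

    flip-inverseˡ : ∀ σ → permutationMatrix (flip σ) ⊡ permutationMatrix σ ≋ identityMatrix
    flip-inverseˡ σ i j =
      trans (permutationMatrix-⊡ (flip σ) (permutationMatrix σ) i j) (reflexive (entry σ i j))

  -- This is Ad(g⁻¹), hence a right action. It agrees by computation with one component of `Ad⁻¹`,
  -- so `InZ` and `InNilradical` are directly statements about `conj`.
  conj : GL → Matrix → Matrix
  conj g N = inverse g ⊡ N ⊡ matrix g

  -- Elements of `GL` carry their inverse as data, while they are compared through `matrix`.
  -- Uniqueness of inverses closes the gap, so `conj g` depends on `matrix g` alone.
  inverse-cong : ∀ g h → matrix g ≋ matrix h → inverse g ≋ inverse h
  inverse-cong g h e = begin
    inverse g                             ≈⟨ cancelʳ (inverseʳ h) (inverse g) ⟨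
    inverse g ⊡ matrix h ⊡ inverse h      ≈⟨ ⊡-congʳ (⊡-congˡ e) ⟨
    inverse g ⊡ matrix g ⊡ inverse h      ≈⟨ ⊡-congʳ (inverseˡ g) ⟩
    identityMatrix ⊡ inverse h            ≈⟨ ⊡-identityˡ (inverse h) ⟩
    inverse h                             ∎
    where open SetoidReasoning ≋-setoid

  conj-cong : ∀ {g h N N′} → matrix g ≋ matrix h → N ≋ N′ → conj g N ≋ conj h N′
  conj-cong {g} {h} e e′ = ⊡-cong (⊡-cong (inverse-cong g h e) e′) e

  conj-congʳ : ∀ g {N N′} → N ≋ N′ → conj g N ≋ conj g N′
  conj-congʳ g e = conj-cong {g} {g} ≋-refl e

  conj-⊙ : ∀ g h N → conj (g ⊙ h) N ≋ conj h (conj g N)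
  conj-⊙ g h N = begin
    (h⁻¹ ⊡ g⁻¹) ⊡ N ⊡ (matrix g ⊡ matrix h) ≈⟨ ⊡-assoc (h⁻¹ ⊡ g⁻¹ ⊡ N) (matrix g) (matrix h) ⟨
    (h⁻¹ ⊡ g⁻¹) ⊡ N ⊡ matrix g ⊡ matrix h
      ≈⟨ ⊡-congʳ (≋-trans (⊡-congʳ (⊡-assoc h⁻¹ g⁻¹ N)) (⊡-assoc h⁻¹ (g⁻¹ ⊡ N) (matrix g))) ⟩
    h⁻¹ ⊡ (g⁻¹ ⊡ N ⊡ matrix g) ⊡ matrix h   ∎
    where
    open SetoidReasoning ≋-setoid
    h⁻¹ = inverse h
    g⁻¹ = inverse g

  conj-𝟏 : ∀ N → conj 𝟏 N ≋ N
  conj-𝟏 N = ≋-trans (⊡-identityʳ _) (⊡-identityˡ N)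

  conj-⁻¹ : ∀ g N → conj (g ⁻¹) (conj g N) ≋ N
  conj-⁻¹ g N = begin
    conj (g ⁻¹) (conj g N) ≈⟨ conj-⊙ g (g ⁻¹) N ⟨
    conj (g ⊙ (g ⁻¹)) N    ≈⟨ conj-cong {g ⊙ (g ⁻¹)} {𝟏} (inverseʳ g) ≋-refl ⟩
    conj 𝟏 N               ≈⟨ conj-𝟏 N ⟩
    N                      ∎
    where open SetoidReasoning ≋-setoid

  conj-permutation : ∀ σ N i j →
    conj (permutationGL σ) N i j ≈ N (σ ⟨$⟩ʳ i) (σ ⟨$⟩ʳ j)
  conj-permutation σ N i j = trans
    (⊡-permutationMatrix (permutationMatrix (flip σ) ⊡ N) σ i j)
    (permutationMatrix-⊡ (flip σ) N i (σ ⟨$⟩ʳ j))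

  ⊡-vanishing : ∀ (A B : Matrix) {i j} → (∀ k → A i k ≈ 0# ⊎ B k j ≈ 0#) → (A ⊡ B) i j ≈ 0#
  ⊡-vanishing A B {i} {j} h = sum-zero +-monoid _ λ k → [
      (λ e → trans (*-congʳ e) (zeroˡ (B k j)))
    , (λ e → trans (*-congˡ e) (zeroʳ (A i k))) ]′ (h k)

  module _ (R : StandardParabolic n) where

    -- In each term the block of `k` is compared with that of the row `i`: if it comes early enough
    -- the first factor vanishes, otherwise the second does. Where the comparison is strict is what
    -- distinguishes this lemma from the next two, which make 𝔫 a two-sided ideal of 𝔭.
    LieParabolic-⊡ : ∀ {A B} → LieParabolic R A → LieParabolic R B → LieParabolic R (A ⊡ B)
    LieParabolic-⊡ {A} {B} hA hB i j j<i = ⊡-vanishing A B λ k →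
        Sum.map (hA i k) (λ i≤k → hB k j (ℕ.<-≤-trans j<i i≤k))
        (ℕ.<-≤-connex (block R k) (block R i))

    LieNilradical-⊡ʳ : ∀ {A B} → LieNilradical R A → LieParabolic R B → LieNilradical R (A ⊡ B)
    LieNilradical-⊡ʳ {A} {B} hA hB i j j≤i = ⊡-vanishing A B λ k →
        Sum.map (hA i k) (λ i<k → hB k j (ℕ.≤-<-trans j≤i i<k))
        (ℕ.≤-<-connex (block R k) (block R i))

    LieNilradical-⊡ˡ : ∀ {A B} → LieParabolic R A → LieNilradical R B → LieNilradical R (A ⊡ B)
    LieNilradical-⊡ˡ {A} {B} hA hB i j j≤i = ⊡-vanishing A B λ k →
        Sum.map (hA i k) (λ i≤k → hB k j (ℕ.≤-trans j≤i i≤k))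
        (ℕ.<-≤-connex (block R k) (block R i))

    conj-LieParabolic : ∀ {g N} → InParabolic R g → LieParabolic R N → LieParabolic R (conj g N)
    conj-LieParabolic (h , h⁻¹) hN = LieParabolic-⊡ (LieParabolic-⊡ h⁻¹ hN) h

    conj-LieNilradical : ∀ {g N} → InParabolic R g → LieNilradical R N → LieNilradical R (conj g N)
    conj-LieNilradical (h , h⁻¹) hN = LieNilradical-⊡ʳ (LieNilradical-⊡ˡ h⁻¹ hN) h

    LieBorel⊆LieParabolic : ∀ {A} → LieParabolic Borel A → LieParabolic R A
    LieBorel⊆LieParabolic hA i j j<i = hA i j (ℕ.≰⇒> λ i≤j → ℕ.<⇒≱ j<i (monotone R i≤j))

    Borel⊆Parabolic : ∀ {g} → InParabolic Borel g → InParabolic R g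
    Borel⊆Parabolic (h , h⁻¹) = LieBorel⊆LieParabolic h , LieBorel⊆LieParabolic h⁻¹

    InParabolic-⁻¹ : ∀ {g} → InParabolic R g → InParabolic R (g ⁻¹)
    InParabolic-⁻¹ = swap

    𝟏∈Parabolic : InParabolic R 𝟏
    𝟏∈Parabolic = h , h
      where
      h : LieParabolic R identityMatrix
      h i j j<i = reflexive (if-false (i ≟ j) λ { ≡.refl → ℕ.<-irrefl ≡.refl j<i })

    LieNilradical-resp-≋ : ∀ {A B} → A ≋ B → LieNilradical R A → LieNilradical R B
    LieNilradical-resp-≋ e h i j j≤i = trans (sym (e i j)) (h i j j≤i)

    LieParabolic-resp-≋ : ∀ {A B} → A ≋ B → LieParabolic R A → LieParabolic R B
    LieParabolic-resp-≋ e h i j j<i = trans (sym (e i j)) (h i j j<i)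

-- Integers inside the rationals, and order arguments on `Fin n`.

ι : ℤ → ℚ
ι a = a ℚ./ 1

-- The normalised fraction `a / 1` does not compute for a variable `a`. Among unnormalised fractions
-- the claim is an identity of integers.
ι-+ : ∀ a b → ι (a ℤ.+ b) ≡ ι a ℚ.+ ι b
ι-+ a b = ℚ.toℚᵘ-injective (begin
  ℚ.toℚᵘ (ι (a ℤ.+ b))              ≈⟨ ℚ.toℚᵘ-fromℚᵘ (mkℚᵘ (a ℤ.+ b) 0) ⟩
  mkℚᵘ (a ℤ.+ b) 0                   ≈⟨ *≡* (identity a b) ⟩
  mkℚᵘ a 0 ℚᵘ.+ mkℚᵘ b 0             ≈⟨ ℚᵘ.+-cong (ℚ.toℚᵘ-fromℚᵘ (mkℚᵘ a 0)) (ℚ.toℚᵘ-fromℚᵘ (mkℚᵘ b 0)) ⟨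
  ℚ.toℚᵘ (ι a) ℚᵘ.+ ℚ.toℚᵘ (ι b)     ≈⟨ ℚ.toℚᵘ-homo-+ (ι a) (ι b) ⟨
  ℚ.toℚᵘ (ι a ℚ.+ ι b)               ∎)
  where
  open import Relation.Binary.Reasoning.Setoid ℚᵘ.≃-setoid
  identity : ∀ a b → (a ℤ.+ b) ℤ.* (+ 1) ≡ (a ℤ.* (+ 1) ℤ.+ b ℤ.* (+ 1)) ℤ.* (+ 1)
  identity = ℤSolver.solve-∀

ι-sub : ∀ a b → ι (a ℤ.- b) ≡ ι a ℚ.- ι b
ι-sub a b = begin
  ι (a ℤ.- b)                    ≡⟨ solve 2 (λ x y → x := (x :+ y) :- y) ≡.refl (ι (a ℤ.- b)) (ι b) ⟩
  (ι (a ℤ.- b) ℚ.+ ι b) ℚ.- ι b  ≡⟨ ≡.cong (ℚ._- ι b) (ι-+ (a ℤ.- b) b) ⟨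
  ι (a ℤ.- b ℤ.+ b) ℚ.- ι b      ≡⟨ ≡.cong (λ x → ι x ℚ.- ι b) (identity a b) ⟩
  ι a ℚ.- ι b                    ∎
  where
  open ≡.≡-Reasoning
  open +-*-Solver using (solve; _:=_; _:+_; _:-_)
  identity : ∀ a b → a ℤ.- b ℤ.+ b ≡ a
  identity = ℤSolver.solve-∀

ι-injective : ∀ {a b} → ι a ≡ ι b → a ≡ b
ι-injective {a} {b} e with ℚ.fromℚᵘ-injective {mkℚᵘ a 0} {mkℚᵘ b 0} e
... | *≡* h = ℤ.*-cancelʳ-≡ a b (+ 1) h

ι-nonNegative : ∀ {a} → 0ℤ ℤ.≤ a → 0ℚ ℚ.≤ ι a
ι-nonNegative {a} h = ℚ.toℚᵘ-cancel-≤ (ℚᵘ.≤-respʳ-≃ (ℚᵘ.≃-sym (ℚ.toℚᵘ-fromℚᵘ (mkℚᵘ a 0)))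
  (*≤* (ℤ.*-monoʳ-≤-nonNeg (+ 1) h)))

ι-nonNegative⁻¹ : ∀ {a} → 0ℚ ℚ.≤ ι a → 0ℤ ℤ.≤ a
ι-nonNegative⁻¹ {a} h with ℚᵘ.≤-respʳ-≃ (ℚ.toℚᵘ-fromℚᵘ (mkℚᵘ a 0)) (ℚ.toℚᵘ-mono-≤ h)
... | *≤* h′ = ℤ.*-cancelʳ-≤-pos 0ℤ a (+ 1) h′

-- A pair `i < j` is joined by a chain of adjacent steps, split off from the left. Transitivity is
-- asked only along `i < j < k`: the relation used for `Decreasing` needs the middle index to lie
-- between the outer ones.
adjacent-induction : ∀ {ℓ n} (R : Fin n → Fin n → Set ℓ) →
  (∀ i j k → i Fin.< j → j Fin.< k → R i j → R j k → R i k) →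
  (∀ i j → toℕ j ≡ ℕ.suc (toℕ i) → R i j) →
  ∀ i j → i Fin.< j → R i j
adjacent-induction R tr step zero (suc zero) i<j = step zero (suc zero) ≡.refl
adjacent-induction R tr step zero (suc (suc j)) i<j =
  tr zero (suc zero) (suc (suc j)) ℕ.z<s (s<s ℕ.z<s) (step zero (suc zero) ≡.refl)
    (adjacent-induction (λ i j → R (suc i) (suc j))
      (λ i j k i<j j<k → tr (suc i) (suc j) (suc k) (s<s i<j) (s<s j<k))
      (λ i j adj → step (suc i) (suc j) (≡.cong ℕ.suc adj)) zero (suc j) ℕ.z<s)
adjacent-induction R tr step (suc i) (suc j) i<j =
  adjacent-induction (λ i j → R (suc i) (suc j))
    (λ i j k i<j j<k → tr (suc i) (suc j) (suc k) (s<s i<j) (s<s j<k))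
    (λ i j adj → step (suc i) (suc j) (≡.cong ℕ.suc adj)) i j (s<s⁻¹ i<j)

-- As `f` is monotone, `f i < f j` forces `i < j`, hence `g i ≤ g j`; equality is excluded because
-- the fibres of `g` refine those of `f`. Used in both directions, it shows that monotone functions
-- with the same level sets have the same strict inequalities.
<-transfer : ∀ {n} {f g : Fin n → ℤ} →
  (∀ {i j} → i Fin.≤ j → f i ℤ.≤ f j) → (∀ {i j} → i Fin.≤ j → g i ℤ.≤ g j) →
  (∀ i j → g i ≡ g j → f i ≡ f j) →
  ∀ i j → f i ℤ.< f j → g i ℤ.< g j
<-transfer f-mono g-mono fibre i j fi<fj = ℤ.≤∧≢⇒<
  (g-mono (ℕ.<⇒≤ (ℕ.≰⇒> λ j≤i → ℤ.<⇒≱ fi<fj (f-mono j≤i))))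
  (ℤ.<⇒≢ fi<fj ∘ fibre i j)

opposite-antitone : ∀ {n} {i j : Fin n} → i Fin.≤ j → opposite j Fin.≤ opposite i
opposite-antitone {n} {i} {j} i≤j = ≡.subst₂ ℕ._≤_
  (≡.sym (opposite-prop j)) (≡.sym (opposite-prop i)) (ℕ.∸-monoʳ-≤ n (ℕ.s≤s i≤j))

transpose-fixes : ∀ {a n} {A : Set a} (f : Fin n → A) {i j} → f i ≡ f j →
  ∀ k → f (PC.transpose i j k) ≡ f k
transpose-fixes f {i} {j} fi≡fj k with k ≟ i
... | yes ≡.refl = ≡.sym fi≡fj
... | no _ with k ≟ j
...   | yes ≡.refl = fi≡fj
...   | no _ = ≡.refl

transpose-second : ∀ {n} (i j : Fin n) → PC.transpose i j j ≡ i
transpose-second i j with j ≟ i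
... | yes j≡i = j≡i
... | no _ with j ≟ j
...   | yes _ = ≡.refl
...   | no j≢j = contradiction ≡.refl j≢j

-- The half sum of the positive roots and the dot action.

module Weights (r n : ℕ) where
  open RootDatum r n
  open CommutativeMonoidSum ℚ.+-0-commutativeMonoid using (sum; sum-cong-≗; ∑-distrib-+)

  private
    -- The contribution to coordinate `k` of 2ρ₀ of the positive root joining `j` and `k`: `1` for
    -- ε_k - ε_j, `-1` for ε_j - ε_k.
    sign : ∀ {m} → Fin m → Fin m → ℚ
    sign k j = (if does (k <? j) then 1ℚ else 0ℚ) ℚ.+ (if does (j <? k) then ℚ.- 1ℚ else 0ℚ)

    sum-one : ∀ m → sum {m} (λ _ → 1ℚ) ≡ ι (+ m)
    sum-one ℕ.zero    = ≡.refl
    sum-one (ℕ.suc m) = ≡.trans (≡.cong (1ℚ ℚ.+_) (sum-one m)) (≡.sym (ι-+ (+ 1) (+ m)))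

    -- There are m - 1 - k indices after `k` and k before it. In the induction, the new index `zero`
    -- lies before `suc k` and contributes `-1`.
    sum-sign : ∀ {m} (k : Fin m) → sum (sign k) ≡ ι (+ m) ℚ.- 1ℚ ℚ.- (ι (+ toℕ k) ℚ.+ ι (+ toℕ k))
    sum-sign {ℕ.suc m} zero = begin
      0ℚ ℚ.+ sum {m} (λ _ → 1ℚ)   ≡⟨ ≡.cong (0ℚ ℚ.+_) (sum-one m) ⟩
      0ℚ ℚ.+ ι (+ m)
        ≡⟨ solve 1 (λ x → con 0ℚ :+ x := con 1ℚ :+ x :- con 1ℚ :- (con 0ℚ :+ con 0ℚ))
             ≡.refl (ι (+ m)) ⟩
      1ℚ ℚ.+ ι (+ m) ℚ.- 1ℚ ℚ.- (0ℚ ℚ.+ 0ℚ)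
        ≡⟨ ≡.cong (λ x → x ℚ.- 1ℚ ℚ.- (0ℚ ℚ.+ 0ℚ)) (ι-+ (+ 1) (+ m)) ⟨
      ι (+ ℕ.suc m) ℚ.- 1ℚ ℚ.- (0ℚ ℚ.+ 0ℚ)   ∎
      where
      open ≡.≡-Reasoning
      open +-*-Solver
    sum-sign {ℕ.suc m} (suc k) = begin
      ℚ.- 1ℚ ℚ.+ sum (sign k)     ≡⟨ ≡.cong (ℚ.- 1ℚ ℚ.+_) (sum-sign k) ⟩
      ℚ.- 1ℚ ℚ.+ (M ℚ.- 1ℚ ℚ.- (K ℚ.+ K))
        ≡⟨ solve 2 (λ M K → con (ℚ.- 1ℚ) :+ (M :- con 1ℚ :- (K :+ K)) :=
             con 1ℚ :+ M :- con 1ℚ :- ((con 1ℚ :+ K) :+ (con 1ℚ :+ K))) ≡.refl M K ⟩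
      1ℚ ℚ.+ M ℚ.- 1ℚ ℚ.- ((1ℚ ℚ.+ K) ℚ.+ (1ℚ ℚ.+ K))
        ≡⟨ ≡.cong₂ (λ x y → x ℚ.- 1ℚ ℚ.- (y ℚ.+ y)) (ι-+ (+ 1) (+ m)) (ι-+ (+ 1) (+ toℕ k)) ⟨
      ι (+ ℕ.suc m) ℚ.- 1ℚ ℚ.- (ι (+ ℕ.suc (toℕ k)) ℚ.+ ι (+ ℕ.suc (toℕ k))) ∎
      where
      open ≡.≡-Reasoning
      open +-*-Solver
      M = ι (+ m)
      K = ι (+ toℕ k)

    ρ₀-max : ℚ
    ρ₀-max = ½ ℚ.* (ι (+ n) ℚ.- 1ℚ)

  -- The double sum is split into its ε_i and -ε_j parts. The first is supported on the row `i = k`,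
  -- the second on the column `j = k`; the two remaining single sums recombine into `sign k`.
  ρ₀-entry : ∀ τ k → ρ₀ τ k ≡ ρ₀-max ℚ.- ι (+ toℕ k)
  ρ₀-entry τ k = begin
    ½ ℚ.* Σₙ (λ i → Σₙ λ j → if does (i <? j) then root i j k else 0ℚ)
      ≡⟨ ≡.cong (½ ℚ.*_) (sum-cong-≗ λ i → ≡.trans
           (sum-cong-≗ λ j → split (does (i <? j)) (ε i k) (ε j k))
           (∑-distrib-+ {n} (left i) (right i))) ⟩
    ½ ℚ.* Σₙ (λ i → Σₙ (left i) ℚ.+ Σₙ (right i))
      ≡⟨ ≡.cong (½ ℚ.*_) (∑-distrib-+ {n} (λ i → Σₙ (left i)) (λ i → Σₙ (right i))) ⟩
    ½ ℚ.* (Σₙ (λ i → Σₙ (left i)) ℚ.+ Σₙ (λ i → Σₙ (right i)))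
      ≡⟨ ≡.cong₂ (λ x y → ½ ℚ.* (x ℚ.+ y)) sum-left (sum-cong-≗ sum-right) ⟩
    ½ ℚ.* (Σₙ above ℚ.+ Σₙ below)
      ≡⟨ ≡.cong (½ ℚ.*_) (∑-distrib-+ {n} above below) ⟨
    ½ ℚ.* Σₙ (sign k)
      ≡⟨ ≡.cong (½ ℚ.*_) (sum-sign k) ⟩
    ½ ℚ.* (ι (+ n) ℚ.- 1ℚ ℚ.- (ι (+ toℕ k) ℚ.+ ι (+ toℕ k)))
      ≡⟨ solve 2 (λ N K → con ½ :* (N :- con 1ℚ :- (K :+ K)) := con ½ :* (N :- con 1ℚ) :- K)
           ≡.refl (ι (+ n)) (ι (+ toℕ k)) ⟩
    ρ₀-max ℚ.- ι (+ toℕ k) ∎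
    where
    open ≡.≡-Reasoning
    open +-*-Solver using (solve; con; _:=_; _:+_; _:-_; _:*_)

    Σₙ : (Fin n → ℚ) → ℚ
    Σₙ = sum

    left right : Fin n → Fin n → ℚ
    left  i j = if does (i <? j) then ε i k else 0ℚ
    right i j = if does (i <? j) then ℚ.- ε j k else 0ℚ

    above below : Fin n → ℚ
    above j = if does (k <? j) then 1ℚ else 0ℚ
    below i = if does (i <? k) then ℚ.- 1ℚ else 0ℚ

    split : ∀ b (x y : ℚ) →
      (if b then x ℚ.- y else 0ℚ) ≡ (if b then x else 0ℚ) ℚ.+ (if b then ℚ.- y else 0ℚ)
    split true  x y = ≡.refl
    split false x y = ≡.refl

    if-zero : ∀ b {x : ℚ} → x ≡ 0ℚ → (if b then x else 0ℚ) ≡ 0ℚ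
    if-zero true  x≡0 = x≡0
    if-zero false x≡0 = ≡.refl

    ε-diagonal : ε k k ≡ 1ℚ
    ε-diagonal = if-true (k ≟ k) ≡.refl

    ε-off-diagonal : ∀ {i} → i ≢ k → ε i k ≡ 0ℚ
    ε-off-diagonal {i} = if-false (i ≟ k)

    sum-left : Σₙ (λ i → Σₙ (left i)) ≡ Σₙ above
    sum-left = ≡.trans
      (sum-single ℚ.+-0-monoid (λ i → Σₙ (left i)) k λ i i≢k →
        sum-zero ℚ.+-0-monoid (left i) λ j → if-zero (does (i <? j)) (ε-off-diagonal i≢k))
      (sum-cong-≗ {n} λ j → ≡.cong (if does (k <? j) then_else 0ℚ) ε-diagonal)

    sum-right : ∀ i → Σₙ (right i) ≡ below i
    sum-right i = ≡.trans
      (sum-single ℚ.+-0-monoid (right i) k λ j j≢k →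
        if-zero (does (i <? j)) (≡.cong ℚ.-_ (ε-off-diagonal j≢k)))
      (≡.cong (λ x → if does (i <? k) then ℚ.- x else 0ℚ) ε-diagonal)

  -- By ρ₀-entry this is ν + ρ₀ up to adding a constant, which the dot action does not see.
  shift : (Fin r → Fin n → ℤ) → Fin r → Fin n → ℤ
  shift ν τ i = ν τ i ℤ.- + toℕ i

  -- The half-integral constant `ρ₀-max` occurs once with each sign and cancels, so the dot action
  -- becomes a permutation of the integers `shift ν`. Assuming only `μ ≐ fromIntegral ν` lets the
  -- results on stabilisers apply to w₀·λ as well.
  dot-integral : ∀ v {μ} ν → μ ≐ fromIntegral ν →
    v · μ ≐ fromIntegral (λ τ i → shift ν τ (v τ ⟨$⟩ˡ i) ℤ.+ + toℕ i)
  dot-integral v {μ} ν μ≐ν τ i = begin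
    μ τ k ℚ.+ ρ₀ τ k ℚ.- ρ₀ τ i
      ≡⟨ ≡.cong₂ (λ x y → x ℚ.- y) (≡.cong₂ ℚ._+_ (μ≐ν τ k) (ρ₀-entry τ k)) (ρ₀-entry τ i) ⟩
    ι (ν τ k) ℚ.+ (ρ₀-max ℚ.- ι (+ toℕ k)) ℚ.- (ρ₀-max ℚ.- ι (+ toℕ i))
      ≡⟨ solve 4 (λ a c k i → a :+ (c :- k) :- (c :- i) := (a :- k) :+ i)
           ≡.refl (ι (ν τ k)) ρ₀-max (ι (+ toℕ k)) (ι (+ toℕ i)) ⟩
    (ι (ν τ k) ℚ.- ι (+ toℕ k)) ℚ.+ ι (+ toℕ i)
      ≡⟨ ≡.cong (ℚ._+ ι (+ toℕ i)) (ι-sub (ν τ k) (+ toℕ k)) ⟨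
    ι (shift ν τ k) ℚ.+ ι (+ toℕ i)
      ≡⟨ ι-+ (shift ν τ k) (+ toℕ i) ⟨
    ι (shift ν τ k ℤ.+ + toℕ i) ∎
    where
    open ≡.≡-Reasoning
    open +-*-Solver using (solve; _:=_; _:+_; _:-_)
    k = v τ ⟨$⟩ˡ i

  dot-fixes⇔ : ∀ v {μ} ν → μ ≐ fromIntegral ν →
    v · μ ≐ μ ⇔ (∀ τ i → shift ν τ (v τ ⟨$⟩ˡ i) ≡ shift ν τ i)
  dot-fixes⇔ v {μ} ν μ≐ν = mk⇔
    (λ h τ i → add-cancel (shift ν τ (v τ ⟨$⟩ˡ i)) (+ toℕ i) (ν τ i) (ι-injective
      (≡.trans (≡.sym (dot-integral v ν μ≐ν τ i)) (≡.trans (h τ i) (μ≐ν τ i)))))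
    (λ h τ i → ≡.trans (dot-integral v ν μ≐ν τ i)
      (≡.trans
        (≡.cong ι (≡.trans (≡.cong (ℤ._+ + toℕ i) (h τ i)) (cancel (ν τ i) (+ toℕ i))))
        (≡.sym (μ≐ν τ i))))
    where
    cancel : ∀ a b → a ℤ.- b ℤ.+ b ≡ a
    cancel = ℤSolver.solve-∀
    cancel′ : ∀ a b → a ≡ a ℤ.+ b ℤ.- b
    cancel′ = ℤSolver.solve-∀
    add-cancel : ∀ a b c → a ℤ.+ b ≡ c → a ≡ c ℤ.- b
    add-cancel a b _ e = ≡.trans (cancel′ a b) (≡.cong (ℤ._- b) e)

  at : Fin r → Permutation′ n → W
  at τ π τ′ = if does (τ′ ≟ τ) then π else Perm.id

  at-same : ∀ τ π → at τ π τ ≡ π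
  at-same τ π = if-true (τ ≟ τ) ≡.refl

  -- The stabiliser hypothesis is tested on one transposition in one factor. Exchanging `i` and `j`
  -- lies in W_P exactly when their blocks agree, and fixes `μ` exactly when their `shift` values
  -- agree.
  blocks⇔shift : ∀ {P μ} ν → μ ≐ fromIntegral ν → LeviWeylGroupIsStabiliser P μ →
    ∀ τ i j → block (P τ) i ≡ block (P τ) j ⇔ shift ν τ i ≡ shift ν τ j
  blocks⇔shift {P} {μ} ν μ≐ν stab τ i j = mk⇔
    (λ same → ≡.trans (≡.cong (shift ν τ) (≡.sym vˡj≡i))
      (to (dot-fixes⇔ v ν μ≐ν) (to (stab v) (levi same)) τ j))
    (λ same → ≡.trans (≡.sym (from (stab v) (from (dot-fixes⇔ v ν μ≐ν) (fixed same)) τ i))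
      (≡.cong (block (P τ)) vʳi≡j))
    where
    open Equivalence
    -- The inverse of `transpose j i` is computed by exchanging the two arguments, so
    -- `transpose-second` evaluates `v` at `i` and its inverse at `j`.
    v = at τ (Perm.transpose j i)

    vˡj≡i : v τ ⟨$⟩ˡ j ≡ i
    vˡj≡i = ≡.trans (≡.cong (_⟨$⟩ˡ j) (at-same τ (Perm.transpose j i))) (transpose-second i j)

    vʳi≡j : v τ ⟨$⟩ʳ i ≡ j
    vʳi≡j = ≡.trans (≡.cong (_⟨$⟩ʳ i) (at-same τ (Perm.transpose j i))) (transpose-second j i)

    levi : block (P τ) i ≡ block (P τ) j → InLeviWeylGroup P v
    levi same τ′ k with τ′ ≟ τ
    ... | yes ≡.refl = transpose-fixes (block (P τ)) (≡.sym same) k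
    ... | no _ = ≡.refl

    fixed : shift ν τ i ≡ shift ν τ j → ∀ τ′ k → shift ν τ′ (v τ′ ⟨$⟩ˡ k) ≡ shift ν τ′ k
    fixed same τ′ k with τ′ ≟ τ
    ... | yes ≡.refl = transpose-fixes (shift ν τ) same k
    ... | no _ = ≡.refl

  -- The combinatorial condition through which weights and geometry communicate. It runs over all
  -- pairs `i < j`, not just adjacent ones, because the geometry involves every E_ij of 𝔲.
  Decreasing : Parabolic → W → Parabolic → Set
  Decreasing P w Q = ∀ τ i j → i Fin.< j → block (Q τ) i ≡ block (Q τ) j →
    block (P τ) (w τ ⟨$⟩ˡ j) ℕ.< block (P τ) (w τ ⟨$⟩ˡ i)

  -- Dominance as a condition on the blocks of `P`.

  module _ (λ₀ : Fin r → Fin n → ℤ)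
           (almostDominant : ∀ τ i j → Adjacent i j → -1ℤ ≤ λ₀ τ i - λ₀ τ j) where

    private
      -- This is η = w₀(λ + ρ₀) with the constant `ρ₀-max` removed, which keeps it integral.
      antidominant : Fin r → Fin n → ℤ
      antidominant τ i = shift λ₀ τ (opposite i)

      shift-antitone : ∀ τ i j → i Fin.< j → shift λ₀ τ j ℤ.≤ shift λ₀ τ i
      shift-antitone τ = adjacent-induction (λ i j → shift λ₀ τ j ℤ.≤ shift λ₀ τ i)
        (λ _ _ _ _ _ h h′ → ℤ.≤-trans h′ h) adjacent
        where
        adjacent : ∀ i j → Adjacent i j → shift λ₀ τ j ℤ.≤ shift λ₀ τ i
        -- Passing to `shift` raises the difference of adjacent entries by 1, which exactly absorbs
        -- the lower bound `-1ℤ` and leaves 0.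
        adjacent i j adj = ℤ.0≤i-j⇒j≤i (≡.subst (0ℤ ℤ.≤_)
          (≡.trans (identity (λ₀ τ i) (λ₀ τ j) (+ toℕ i))
            (≡.cong (λ m → (λ₀ τ i ℤ.- + toℕ i) ℤ.- (λ₀ τ j ℤ.- + m)) (≡.sym adj)))
          (ℤ.+-monoʳ-≤ (+ 1) (almostDominant τ i j adj)))
          where
          identity : ∀ a b k → + 1 ℤ.+ (a ℤ.- b) ≡ (a ℤ.- k) ℤ.- (b ℤ.- (+ 1 ℤ.+ k))
          identity = ℤSolver.solve-∀

      antidominant-monotone : ∀ τ {i j} → i Fin.≤ j → antidominant τ i ℤ.≤ antidominant τ j
      antidominant-monotone τ {i} {j} i≤j with ℕ.m≤n⇒m<n∨m≡n (opposite-antitone i≤j)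
      ... | inj₁ h = shift-antitone τ (opposite j) (opposite i) h
      ... | inj₂ h = ℤ.≤-reflexive (≡.cong (shift λ₀ τ) (toℕ-injective (≡.sym h)))

      -- The inverse of ww₀ is w₀ after w⁻¹, so the entries of `shift λ₀` that occur are
      -- `antidominant` at w⁻¹(i) and w⁻¹(j). Undoing the shift lowers their difference by 1, which
      -- turns a weak inequality into a strict one.
      adjacent-dominant⇔ : ∀ w τ i j → Adjacent i j →
        0ℚ ℚ.≤ ⟨coroot τ , i , j ∣ (w ∙ w₀) · fromIntegral λ₀ ⟩ ⇔
        antidominant τ (w τ ⟨$⟩ˡ j) ℤ.< antidominant τ (w τ ⟨$⟩ˡ i)
      adjacent-dominant⇔ w τ i j adj = mk⇔
        (λ h → ℤ.suc[i]≤j⇒i<j (ℤ.0≤i-j⇒j≤i (ι-nonNegative⁻¹ (≡.subst (0ℚ ℚ.≤_) pairing h))))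
        (λ h → ≡.subst (0ℚ ℚ.≤_) (≡.sym pairing) (ι-nonNegative (ℤ.i≤j⇒0≤j-i (ℤ.i<j⇒suc[i]≤j h))))
        where
        a = antidominant τ (w τ ⟨$⟩ˡ i)
        b = antidominant τ (w τ ⟨$⟩ˡ j)
        identity : ∀ a b k → (a ℤ.+ k) ℤ.- (b ℤ.+ (+ 1 ℤ.+ k)) ≡ a ℤ.- (+ 1 ℤ.+ b)
        identity = ℤSolver.solve-∀
        pairing : ⟨coroot τ , i , j ∣ (w ∙ w₀) · fromIntegral λ₀ ⟩ ≡ ι (a ℤ.- (+ 1 ℤ.+ b))
        pairing = begin
          ⟨coroot τ , i , j ∣ (w ∙ w₀) · fromIntegral λ₀ ⟩
            ≡⟨ ≡.cong₂ ℚ._-_ (dot-integral (w ∙ w₀) λ₀ (λ _ _ → ≡.refl) τ i)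
                             (dot-integral (w ∙ w₀) λ₀ (λ _ _ → ≡.refl) τ j) ⟩
          ι (a ℤ.+ + toℕ i) ℚ.- ι (b ℤ.+ + toℕ j)
            ≡⟨ ι-sub (a ℤ.+ + toℕ i) (b ℤ.+ + toℕ j) ⟨
          ι ((a ℤ.+ + toℕ i) ℤ.- (b ℤ.+ + toℕ j))
            ≡⟨ ≡.cong (λ m → ι ((a ℤ.+ + toℕ i) ℤ.- (b ℤ.+ + m))) adj ⟩
          ι ((a ℤ.+ + toℕ i) ℤ.- (b ℤ.+ (+ 1 ℤ.+ + toℕ i)))
            ≡⟨ ≡.cong ι (identity a b (+ toℕ i)) ⟩
          ι (a ℤ.- (+ 1 ℤ.+ b)) ∎
          where open ≡.≡-Reasoning

    module _ (P : Parabolic) (stab : LeviWeylGroupIsStabiliser P (w₀ · fromIntegral λ₀)) where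

      private
        -- By `dot-integral`, w₀·λ is the integral weight `antidominant` plus the index, and its
        -- `shift` is `antidominant` again.
        blocks⇔antidominant : ∀ τ i j →
          block (P τ) i ≡ block (P τ) j ⇔ antidominant τ i ≡ antidominant τ j
        blocks⇔antidominant τ i j = ≡.subst₂ (λ a b → block (P τ) i ≡ block (P τ) j ⇔ a ≡ b)
          (cancel (antidominant τ i) (+ toℕ i)) (cancel (antidominant τ j) (+ toℕ j))
          (blocks⇔shift {P} (λ τ i → antidominant τ i ℤ.+ + toℕ i)
            (dot-integral w₀ λ₀ (λ _ _ → ≡.refl)) stab τ i j)
          where
          cancel : ∀ a b → a ℤ.+ b ℤ.- b ≡ a
          cancel = ℤSolver.solve-∀

        block-<⇔ : ∀ τ i j →
          block (P τ) i ℕ.< block (P τ) j ⇔ antidominant τ i ℤ.< antidominant τ j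
        block-<⇔ τ i j = mk⇔
          (λ h → <-transfer {f = +_ ∘ block (P τ)}
            (ℤ.+≤+ ∘ monotone (P τ)) (antidominant-monotone τ)
            (λ i j → ≡.cong +_ ∘ from (blocks⇔antidominant τ i j)) i j (ℤ.+<+ h))
          (λ h → ℤ.drop‿+<+ (<-transfer {g = +_ ∘ block (P τ)}
            (antidominant-monotone τ) (ℤ.+≤+ ∘ monotone (P τ))
            (λ i j → to (blocks⇔antidominant τ i j) ∘ ℤ.+-injective) i j h))
          where open Equivalence

      dominant⇔decreasing : ∀ Q w →
        DominantForLevi Q ((w ∙ w₀) · fromIntegral λ₀) ⇔ Decreasing P w Q
      dominant⇔decreasing Q w = mk⇔
        (λ dominant τ → adjacent-induction
          (λ i j → block (Q τ) i ≡ block (Q τ) j →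
            block (P τ) (w τ ⟨$⟩ˡ j) ℕ.< block (P τ) (w τ ⟨$⟩ˡ i))
          (λ i j k i<j j<k h h′ i~k →
            -- Blocks of `Q` are intervals: `j` is squeezed between `i` and `k`, which share a
            -- block, so both shorter inequalities are available.
            let j≤k = ≡.subst (block (Q τ) j ℕ.≤_) (≡.sym i~k) (monotone (Q τ) (ℕ.<⇒≤ j<k))
                i~j = ℕ.≤-antisym (monotone (Q τ) (ℕ.<⇒≤ i<j)) j≤k
            in ℕ.<-trans (h′ (≡.trans (≡.sym i~j) i~k)) (h i~j))
          (λ i j adj i~j → from (block-<⇔ τ (w τ ⟨$⟩ˡ j) (w τ ⟨$⟩ˡ i))
            (to (adjacent-dominant⇔ w τ i j adj) (dominant τ i j adj i~j))))
        (λ decreasing τ i j adj i~j → from (adjacent-dominant⇔ w τ i j adj)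
          (to (block-<⇔ τ (w τ ⟨$⟩ˡ j) (w τ ⟨$⟩ˡ i))
            (decreasing τ i j (ℕ.≤-reflexive (≡.sym adj)) i~j)))
        where open Equivalence

-- The nilradical locus is closed and saturated, and contains the cell of a decreasing `w`.

module SteinbergComponents {c ℓ₁ ℓ₂} (L : HeytingField c ℓ₁ ℓ₂) (r n : ℕ) where
  open RootDatum r n using (Parabolic; W)
  open Weights r n using (Decreasing)
  open Steinberg L r n

  Σᵖ : ∀ {m} → (Fin m → Polynomial) → Polynomial
  Σᵖ {ℕ.zero}  f = con (HeytingField.0# L)
  Σᵖ {ℕ.suc m} f = f zero :+ Σᵖ (f ∘ suc)

  -- Bracketed like the matrix product in `Ad⁻¹`, so that evaluation only has to commute with the
  -- two sums. The entries of g₁⁻¹ are coordinates, so no determinant appears.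
  Ad⁻¹-entry : Fin r → Fin n → Fin n → Polynomial
  Ad⁻¹-entry τ i j = Σᵖ λ l → Σᵖ (λ k → var (g₁⁻¹ᶜ τ i k) :* var (νᶜ τ k l)) :* var (g₁ᶜ τ l j)

  data NilradicalEquation (Q : Parabolic) : Pred Polynomial c where
    entry : ∀ τ i j → block (Q τ) j ℕ.≤ block (Q τ) i →
      NilradicalEquation Q (Ad⁻¹-entry τ i j)

  module _ (K : FieldExtension L) where
    open CommutativeRing (FieldExtension.ring K)
    open Matrices (FieldExtension.ring K) n
    open MatrixProperties (FieldExtension.ring K) n
    open MonoidSum +-monoid using (sum; sum-cong-≋)
    open Point
    private module Embed = RingMorphisms.IsRingHomomorphism (FieldExtension.isRingHomomorphism K)

    evaluate-Σᵖ : ∀ (x : Point K) {m} (f : Fin m → Polynomial) →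
      evaluate x (Σᵖ f) ≈ sum (λ k → evaluate x (f k))
    evaluate-Σᵖ x {ℕ.zero}  f = Embed.0#-homo
    evaluate-Σᵖ x {ℕ.suc m} f = +-congˡ (evaluate-Σᵖ x (f ∘ suc))

    evaluate-Ad⁻¹-entry : ∀ (x : Point K) τ i j →
      evaluate x (Ad⁻¹-entry τ i j) ≈ Ad⁻¹ {K} (g₁ x) (ν x) τ i j
    evaluate-Ad⁻¹-entry x τ i j =
      trans (evaluate-Σᵖ x λ l → Σᵖ (λ k → var (g₁⁻¹ᶜ τ i k) :* var (νᶜ τ k l)) :* var (g₁ᶜ τ l j))
        (sum-cong-≋ λ l → *-congʳ (evaluate-Σᵖ x λ k → var (g₁⁻¹ᶜ τ i k) :* var (νᶜ τ k l)))

    zeroLocus⇒InNilradical : ∀ Q {x} → zeroLocus (NilradicalEquation Q) K x → InNilradical Q x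
    zeroLocus⇒InNilradical Q {x} h τ i j j≤i =
      trans (sym (evaluate-Ad⁻¹-entry x τ i j)) (h _ (entry τ i j j≤i))

    InNilradical⇒zeroLocus : ∀ Q {x} → InNilradical Q x → zeroLocus (NilradicalEquation Q) K x
    InNilradical⇒zeroLocus Q {x} h _ (entry τ i j j≤i) =
      trans (evaluate-Ad⁻¹-entry x τ i j) (h τ i j j≤i)

    -- Replacing g₁ by g₁b applies Ad(b⁻¹) to Ad(g₁⁻¹)ν, and 𝔫_Q is stable under B ⊂ Q. The coset of
    -- g₂ does not enter.
    InNilradical-saturated : ∀ P Q {x y} → SameImage {K} P x y →
      InNilradical Q x → InNilradical Q y
    InNilradical-saturated P Q {x} {y} (ν≋ , (b , hb) , _) h τ =
      LieNilradical-resp-≋ (Q τ) conj≋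
        (conj-LieNilradical (Q τ) {b τ} (Borel⊆Parabolic (Q τ) {b τ} (proj₁ (hb τ))) (h τ))
      where
      conj≋ : conj (b τ) (conj (g₁ x τ) (ν x τ)) ≋ conj (g₁ y τ) (ν y τ)
      conj≋ = ≋-trans (≋-sym (conj-⊙ (g₁ x τ) (b τ) (ν x τ)))
        (conj-cong {g₁ x τ ⊙ b τ} {g₁ y τ} (≋-sym (proj₂ (hb τ))) (ν≋ τ))

    -- Moving the point of the cell to g₁ = 1, g₂ = w by b and q, the two
    -- conditions become conj b (Ad(g₁⁻¹)ν) ∈ 𝔲 ∩ Ad(w)𝔭.
    Cell⇒InNilradical : ∀ P w Q {x} → Decreasing P w Q → Cell P w K x → InNilradical Q x
    Cell⇒InNilradical P w Q {x} decreasing ((hu , hp) , (b , q , hbq)) τ =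
      -- By B-stability of 𝔫_Q it suffices to treat the translate `N`, and then to conjugate back by
      -- b⁻¹.
      LieNilradical-resp-≋ (Q τ) (conj-⁻¹ (b τ) N₁)
        (conj-LieNilradical (Q τ) {b τ ⁻¹}
          (InParabolic-⁻¹ (Q τ) {b τ} (Borel⊆Parabolic (Q τ) {b τ} b∈B)) N∈𝔫)
      where
      b∈B = proj₁ (hbq τ)
      q∈P = proj₁ (proj₂ (hbq τ))
      σ = permutationGL (w τ)
      N₁ = conj (g₁ x τ) (ν x τ)
      N = conj (b τ) N₁

      N∈𝔲 : LieNilradical Borel N
      N∈𝔲 = conj-LieNilradical Borel {b τ} b∈B (hu τ)

      g₂≋ : matrix (g₁ x τ ⊙ (b τ ⊙ σ ⊙ q τ)) ≋ matrix (g₂ x τ)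
      g₂≋ = ≋-trans (⊡-congˡ (≋-sym (proj₂ (proj₂ (hbq τ)))))
        (cancelˡ (inverseʳ (g₁ x τ)) (matrix (g₂ x τ)))

      conj-g₂ : conj (g₂ x τ) (ν x τ) ≋ conj (q τ) (conj σ N)
      conj-g₂ = begin
        conj (g₂ x τ) (ν x τ)
          ≈⟨ conj-cong {g₁ x τ ⊙ (b τ ⊙ σ ⊙ q τ)} {g₂ x τ} g₂≋ ≋-refl ⟨
        conj (g₁ x τ ⊙ (b τ ⊙ σ ⊙ q τ)) (ν x τ)
          ≈⟨ conj-⊙ (g₁ x τ) (b τ ⊙ σ ⊙ q τ) (ν x τ) ⟩
        conj (b τ ⊙ σ ⊙ q τ) N₁
          ≈⟨ conj-⊙ (b τ ⊙ σ) (q τ) N₁ ⟩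
        conj (q τ) (conj (b τ ⊙ σ) N₁)
          ≈⟨ conj-congʳ (q τ) (conj-⊙ (b τ) σ N₁) ⟩
        conj (q τ) (conj σ N) ∎
        where open SetoidReasoning ≋-setoid

      conj-σ∈𝔭 : LieParabolic (P τ) (conj σ N)
      -- The factor `q` lies in P, so conjugating by q⁻¹ removes it without leaving 𝔭.
      conj-σ∈𝔭 = LieParabolic-resp-≋ (P τ) (conj-⁻¹ (q τ) (conj σ N))
        (conj-LieParabolic (P τ) {q τ ⁻¹} (InParabolic-⁻¹ (P τ) {q τ} q∈P)
          (LieParabolic-resp-≋ (P τ) conj-g₂ (hp τ)))

      N∈𝔫 : LieNilradical (Q τ) N
      N∈𝔫 i j j≤i with i <? j
      ... | no i≮j = N∈𝔲 i j (ℕ.≮⇒≥ i≮j)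
      -- Here `i < j` and the block of `j` is not after that of `i`, so monotonicity puts them in
      -- one block of `Q`. By `Decreasing`, the entry at (w⁻¹(i), w⁻¹(j)) then lies below the block
      -- diagonal of P, where 𝔭 vanishes.
      ... | yes i<j = begin
        N i j
          ≡⟨ ≡.cong₂ N (Perm.inverseʳ (w τ)) (Perm.inverseʳ (w τ)) ⟨
        N (w τ ⟨$⟩ʳ (w τ ⟨$⟩ˡ i)) (w τ ⟨$⟩ʳ (w τ ⟨$⟩ˡ j))
          ≈⟨ conj-permutation (w τ) N _ _ ⟨
        conj σ N (w τ ⟨$⟩ˡ i) (w τ ⟨$⟩ˡ j)
          ≈⟨ conj-σ∈𝔭 _ _ (decreasing τ i j i<j (ℕ.≤-antisym (monotone (Q τ) (ℕ.<⇒≤ i<j)) j≤i)) ⟩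
        0# ∎
        where open SetoidReasoning setoid

  -- The closure condition is applied to the single family `NilradicalEquation Q`: its zero locus is
  -- saturated and contains the cell, hence also the closure.
  decreasing⇒contained : ∀ P w Q → Decreasing P w Q → ComponentContained P w Q
  decreasing⇒contained P w Q decreasing K x (x∈Z , closure) =
    x∈Z , zeroLocus⇒InNilradical K Q {x} (closure (NilradicalEquation Q)
      (λ K y z same h → InNilradical⇒zeroLocus K Q {z}
        (InNilradical-saturated K P Q {y} {z} same (zeroLocus⇒InNilradical K Q {y} h)))
      (λ K y y∈cell →
        InNilradical⇒zeroLocus K Q {y} (Cell⇒InNilradical K P w Q {y} decreasing y∈cell)))

  -- The converse, tested on elementary matrices over `L` itself.

  trivialExtension : FieldExtension L
  trivialExtension = record
    { top = L
    ; embed = id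
    ; isRingHomomorphism = Identity.isRingHomomorphism (CommutativeRing.rawRing (fieldRing L)) L.refl
    }
    where module L = HeytingField L

  module _ (P : Parabolic) (w : W) (Q : Parabolic) (contained : ComponentContained P w Q)
           (τ : Fin r) (i j : Fin n) where
    open CommutativeRing (fieldRing L)
    open Matrices (fieldRing L) n
    open MatrixProperties (fieldRing L) n

    private
      isUnit? : ∀ τ′ k l → Dec (τ′ ≡ τ × k ≡ i × l ≡ j)
      isUnit? τ′ k l = (τ′ ≟ τ) ×-dec (k ≟ i) ×-dec (l ≟ j)

      E : Fin r → Matrix
      E τ′ k l = if does (isUnit? τ′ k l) then 1# else 0#

      -- The point (E_ij, 1, w), with E_ij placed in the factor `τ`. All its entries are 0 or 1, so
      -- no larger field than `L` is needed to define it.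
      x : Point trivialExtension
      x = record { ν = E ; g₁ = λ _ → 𝟏 ; g₂ = λ τ → permutationGL (w τ) }

    -- Were the conclusion false, E_ij would lie in 𝔲 ∩ Ad(w)𝔭 and `x` in the cell. Containment
    -- would then put E_ij in 𝔫_Q, although `i` and `j` share a block of `Q`; its entry 1 would be
    -- 0.
    contained⇒decreasing : i Fin.< j → block (Q τ) i ≡ block (Q τ) j →
      block (P τ) (w τ ⟨$⟩ˡ j) ℕ.< block (P τ) (w τ ⟨$⟩ˡ i)
    contained⇒decreasing i<j same with block (P τ) (w τ ⟨$⟩ˡ j) ℕ.<? block (P τ) (w τ ⟨$⟩ˡ i)
    ... | yes h = h
    ... | no ≮ = contradiction 1≈0 1≉0
      where
      E∈𝔲 : ∀ τ′ → LieNilradical Borel (conj 𝟏 (E τ′))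
      E∈𝔲 τ′ = LieNilradical-resp-≋ Borel (≋-sym (conj-𝟏 (E τ′))) λ k l l≤k →
        reflexive (if-false (isUnit? τ′ k l) λ { (_ , ≡.refl , ≡.refl) → ℕ.<⇒≱ i<j l≤k })

      E∈𝔭 : ∀ τ′ → LieParabolic (P τ′) (conj (permutationGL (w τ′)) (E τ′))
      E∈𝔭 τ′ k l l<k = trans (conj-permutation (w τ′) (E τ′) k l)
        (reflexive (if-false (isUnit? τ′ (w τ′ ⟨$⟩ʳ k) (w τ′ ⟨$⟩ʳ l))
          λ { (≡.refl , ≡.refl , ≡.refl) → ≮ (≡.subst₂ (λ l k → block (P τ) l ℕ.< block (P τ) k)
              (≡.sym (Perm.inverseˡ (w τ))) (≡.sym (Perm.inverseˡ (w τ))) l<k) }))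

      position : RelativePosition P w x
      position = (λ _ → 𝟏) , (λ _ → 𝟏) , λ τ′ →
        𝟏∈Parabolic Borel , 𝟏∈Parabolic (P τ′) , ≋-sym (⊡-identityʳ _)

      x∈𝔫 : InNilradical Q x
      -- The point lies in the cell itself, so every closed set containing the cell contains it.
      x∈𝔫 = proj₂ (contained trivialExtension x
        ((E∈𝔲 , E∈𝔭) , λ I _ cell⊆ → cell⊆ trivialExtension x ((E∈𝔲 , E∈𝔭) , position)))

      1≈0 : 1# ≈ 0#
      1≈0 = begin
        1#             ≡⟨ if-true (isUnit? τ i j) (≡.refl , ≡.refl , ≡.refl) ⟨
        E τ i j        ≈⟨ conj-𝟏 (E τ) i j ⟨
        conj 𝟏 (E τ) i j ≈⟨ x∈𝔫 τ i j (ℕ.≤-reflexive (≡.sym same)) ⟩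
        0#             ∎
        where open SetoidReasoning setoid

      1≉0 : ¬ 1# ≈ 0#
      -- Nontriviality comes from the apartness: 1 - 0 is its own inverse, so 1 and 0 are apart and
      -- cannot be equal.
      1≉0 1≈0 = HeytingField.#-irrefl L 1≈0
          (HeytingField.invertible⇒# L (1# , 1*[1-0] , [1-0]*1))
        where
        1-0 : 1# + - 0# ≈ 1#
        1-0 = trans (+-congˡ (trans (sym (+-identityˡ (- 0#))) (-‿inverseʳ 0#))) (+-identityʳ 1#)
        1*[1-0] = trans (*-identityˡ (1# + - 0#)) 1-0
        [1-0]*1 = trans (*-identityʳ (1# + - 0#)) 1-0

theorem1p6 : ∀ {c ℓ₁ ℓ₂} (p : ℕ) → Prime p →
    (L : HeytingField c ℓ₁ ℓ₂) → IsFiniteExtension (ℚₚ p) L →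
    (r n : ℕ) → let open RootDatum r n in let open Steinberg L r n in
    (wt : Fin r → Fin n → ℤ) →
    (∀ τ i j → Adjacent i j → -1ℤ ≤ wt τ i - wt τ j) →
    (P : Parabolic) → LeviWeylGroupIsStabiliser P (w₀ · fromIntegral wt) →
    (Q : Parabolic) (w : W) →
    ComponentContained P w Q ⇔ DominantForLevi Q ((w ∙ w₀) · fromIntegral wt)
theorem1p6 p _ L _ r n wt almostDominant P stab Q w = mk⇔
  (λ contained → from dominant⇔ (contained⇒decreasing P w Q contained))
  (λ dominant → decreasing⇒contained P w Q (to dominant⇔ dominant))
  where
  open Equivalence
  open SteinbergComponents L r n
  dominant⇔ = Weights.dominant⇔decreasing r n wt almostDominant P stab Q w
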